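{- Let $\mathcal{G}$ be the class of finite groups $G$ which can be written as a semidirect product $G = A \rtimes C_m$, where $A$ is a finite abelian group and $C_m$ is a cyclic group of order $m$. In the Farzan–Munro model of group representation, there is a representation of the groups $G = A\rtimes C_m\in\mathcal{G}$ such that the multiplication operation can be performed using $\mathcal{O}(|A|)$ space (words) in $\mathcal{O}(1)$ time. The constants in the $\mathcal{O}$-notation are absolute (independent of $G$, $A$, $m$).
   Context: For groups $A,B$ and a homomorphism $\varphi:B\to\mathrm{Aut}(A)$, the semidirect product $A\rtimes_\varphi B$ is the set $A\times B$ with multiplication $(a_1,b_1)(a_2,b_2)=(a_1\,\varphi(b_1)(a_2),\,b_1b_2)$; $A\rtimes B$ denotes such a product for some $\varphi$. Farzan–Munro model: computation is on a random access machine in which a word is large enough to hold the value of the order $n$ of the input group (words have $\mathcal{O}(\log n)$ bits); random access and arithmetic, logic and comparison operations on words take $\mathcal{O}(1)$ time, and bit-reversal of a word is also available as a native $\mathcal{O}(1)$-time operation. A representation of a class of groups consists of the following. (i) A compression algorithm, which takes a group $G$ of the class and outputs a compressed form of $G$. (ii) A labeling, which (based on the compression) represents each element of $G$ by a label. (iii) A query processing unit, which stores the compressed form of $G$ and, given the labels of two elements $x,y\in G$, returns the label of the product $xy$. Compression and labeling are carried out by an "outside user", who also supplies the labels of the elements to be multiplied to the query processing unit; the time and space used for compression and labeling are not counted. The space of the representation is the number of words used by the query processing unit, and the query time is the worst-case time it uses to answer a multiplication query. -}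

module Defs where

open import Algebra.Bundles using (Group; AbelianGroup)
open import Algebra.Morphism.Structures using (module GroupMorphisms)
import Algebra.Morphism.Construct.Composition as Compose
import Algebra.Morphism.Construct.Identity as Identity
open import Data.Bool.Base using (Bool; _∧_; _∨_; not; if_then_else_) renaming (_xor_ to _⊕_)
open import Data.Fin.Base using (Fin; toℕ; fromℕ<; opposite; finToFun; funToFin)
open import Data.Fin.Properties using (2↔Bool)
open import Data.Integer.Base using (ℤ; +_; -[1+_])
open import Data.List.Base using (List; head; drop)
open import Data.Maybe.Base using (Maybe; just; nothing; maybe; _>>=_)
open import Data.Nat.Base using (ℕ; zero; suc; _+_; _*_; _∸_; _^_; _/_; _%_; _<ᵇ_; _≡ᵇ_)
open import Data.Nat.DivMod using (_mod_)
open import Data.Nat.Logarithm using (⌈log₂_⌉)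
open import Data.Nat.Properties using (_<?_; m^n≢0)
open import Data.Product.Base using (∃; _×_; _,_; proj₁; proj₂)
open import Data.Product.Relation.Binary.Pointwise.NonDependent using (×-isEquivalence)
open import Data.Vec.Base using (Vec; lookup; _[_]≔_; _++_; take)
open import Function.Base using (_∘_; id)
open import Function.Bundles using (Inverse)
open import Level using (Level; _⊔_) renaming (suc to lsuc)
open import Relation.Binary.PropositionalEquality using (_≡_; setoid)
open import Relation.Nullary.Decidable.Core using (yes; no)

private
  variable
    a b c ℓ ℓ₁ ℓ₂ : Level

HasOrder : Group c ℓ → ℕ → Set (c ⊔ ℓ)
HasOrder G n = Inverse (Group.setoid G) (setoid (Fin n))

module _ (G : Group c ℓ) where
  open Group G

  pow : Carrier → ℕ → Carrier
  pow g zero    = ε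
  pow g (suc k) = g ∙ pow g k

  zpow : Carrier → ℤ → Carrier
  zpow g (+ k)    = pow g k
  zpow g -[1+ k ] = pow g (suc k) ⁻¹

  IsCyclic : Set (c ⊔ ℓ)
  IsCyclic = ∃ λ g → ∀ x → ∃ λ k → x ≈ zpow g k

module _ (G : Group a ℓ₁) (H : Group b ℓ₂) where
  private
    module G = Group G
    module H = Group H
  open GroupMorphisms G.rawGroup H.rawGroup

  IsHom : (G.Carrier → H.Carrier) → Set (a ⊔ ℓ₁ ⊔ ℓ₂)
  IsHom = IsGroupHomomorphism

  IsIso : (G.Carrier → H.Carrier) → Set (a ⊔ b ⊔ ℓ₁ ⊔ ℓ₂)
  IsIso = IsGroupIsomorphism

  Isomorphic : Set (a ⊔ b ⊔ ℓ₁ ⊔ ℓ₂)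
  Isomorphic = ∃ IsIso

-- Aut(A), with automorphisms compared pointwise and multiplied by composition.

module _ (A : Group a ℓ) where
  private module A = Group A
  open A using (_≈_)
  open GroupMorphisms A.rawGroup A.rawGroup using (module IsGroupIsomorphism)

  record Automorphism : Set (a ⊔ ℓ) where
    constructor automorphism
    field
      to    : A.Carrier → A.Carrier
      isIso : IsIso A A to

    open IsGroupIsomorphism isIso public

    from : A.Carrier → A.Carrier
    from y = proj₁ (surjective y)

    to-from : ∀ y → to (from y) ≈ y
    to-from y = proj₂ (surjective y) A.refl

    from-cong : ∀ {x y} → x ≈ y → from x ≈ from y
    from-cong {x} {y} x≈y =
      injective (A.trans (to-from x) (A.trans x≈y (A.sym (to-from y))))

    from-to : ∀ x → from (to x) ≈ x
    from-to x = injective (to-from (to x))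

    from-homo : ∀ x y → from (x A.∙ y) ≈ from x A.∙ from y
    from-homo x y = injective (A.trans (to-from (x A.∙ y))
      (A.sym (A.trans (∙-homo (from x) (from y)) (A.∙-cong (to-from x) (to-from y)))))

    from-ε : from A.ε ≈ A.ε
    from-ε = injective (A.trans (to-from A.ε) (A.sym ε-homo))

    from-⁻¹ : ∀ x → from (x A.⁻¹) ≈ from x A.⁻¹
    from-⁻¹ x = injective (A.trans (to-from (x A.⁻¹))
      (A.sym (A.trans (⁻¹-homo (from x)) (A.⁻¹-cong (to-from x)))))

  open Automorphism

  Aut : Group (a ⊔ ℓ) (a ⊔ ℓ)
  Aut = record
    { Carrier = Automorphism
    ; _≈_     = λ f g → ∀ x → to f x ≈ to g x
    ; _∙_     = λ f g → automorphism (to f ∘ to g)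
                  (Compose.isGroupIsomorphism A.trans (isIso g) (isIso f))
    ; ε       = automorphism id (Identity.isGroupIsomorphism A.rawGroup A.refl)
    ; _⁻¹     = inv
    ; isGroup = record
      { isMonoid = record
        { isSemigroup = record
          { isMagma = record
            { isEquivalence = record
              { refl  = λ _ → A.refl
              ; sym   = λ p x → A.sym (p x)
              ; trans = λ p q x → A.trans (p x) (q x)
              }
            ; ∙-cong = λ {f} {_} {_} {k} p q x →
                A.trans (⟦⟧-cong f (q x)) (p (to k x))
            }
          ; assoc = λ _ _ _ _ → A.refl
          }
        ; identity = (λ _ _ → A.refl) , (λ _ _ → A.refl)
        }
      ; inverse = from-to , to-from
      ; ⁻¹-cong = λ {f} {g} p x → injective f
          (A.trans (to-from f x) (A.sym (A.trans (p (from g x)) (to-from g x))))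
      }
    }
    where
    inv : Automorphism → Automorphism
    inv f = automorphism (from f) (record
      { isGroupMonomorphism = record
        { isGroupHomomorphism = record
          { isMonoidHomomorphism = record
            { isMagmaHomomorphism = record
              { isRelHomomorphism = record { cong = from-cong f }
              ; homo = from-homo f
              }
            ; ε-homo = from-ε f
            }
          ; ⁻¹-homo = from-⁻¹ f
          }
        ; injective = λ {x} {y} p →
            A.trans (A.sym (to-from f x)) (A.trans (⟦⟧-cong f p) (to-from f y))
        }
      ; surjective = λ y → to f y , λ p →
          A.trans (from-cong f p) (from-to f y)
      })

module _ (A : Group a ℓ₁) (B : Group b ℓ₂)
         (φ : Group.Carrier B → Automorphism A) (φ-hom : IsHom B (Aut A) φ) where
  private
    module A = Group A
    module B = Group B
    open GroupMorphisms B.rawGroup (Group.rawGroup (Aut A))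
      using (module IsGroupHomomorphism)
    module φ = IsGroupHomomorphism φ-hom

  open Automorphism using (to; ∙-homo; ⟦⟧-cong; ε-homo)

  _⋊_ : Group (a ⊔ b) (ℓ₁ ⊔ ℓ₂)
  _⋊_ = record
    { Carrier = A.Carrier × B.Carrier
    ; _≈_     = λ (a₁ , b₁) (a₂ , b₂) → a₁ A.≈ a₂ × b₁ B.≈ b₂
    ; _∙_     = λ (a₁ , b₁) (a₂ , b₂) → a₁ A.∙ to (φ b₁) a₂ , b₁ B.∙ b₂
    ; ε       = A.ε , B.ε
    ; _⁻¹     = λ (a , b) → to (φ (b B.⁻¹)) (a A.⁻¹) , b B.⁻¹
    ; isGroup = record
      { isMonoid = record
        { isSemigroup = record
          { isMagma = record
            { isEquivalence = ×-isEquivalence A.isEquivalence B.isEquivalence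
            ; ∙-cong = λ (p , q) (r , s) → A.∙-cong p (act-cong q r) , B.∙-cong q s
            }
          ; assoc = λ (a₁ , b₁) (a₂ , b₂) (a₃ , b₃) →
              A.trans (A.assoc _ _ _) (A.∙-congˡ (A.trans
                (A.∙-congˡ (φ.homo b₁ b₂ a₃))
                (A.sym (∙-homo (φ b₁) a₂ (to (φ b₂) a₃)))))
              , B.assoc _ _ _
          }
        ; identity = (λ (a , b) → A.trans (A.identityˡ _) (φ.ε-homo a) , B.identityˡ b)
                   , (λ (a , b) → A.trans (A.∙-congˡ (ε-homo (φ b))) (A.identityʳ a)
                                , B.identityʳ b)
        }
      ; inverse = (λ (a , b) → A.trans (A.sym (∙-homo (φ (b B.⁻¹)) (a A.⁻¹) a))
                                 (A.trans (⟦⟧-cong (φ (b B.⁻¹)) (A.inverseˡ a))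
                                          (ε-homo (φ (b B.⁻¹))))
                             , B.inverseˡ b)
                , (λ (a , b) → A.trans (A.∙-congˡ (A.trans
                                 (A.sym (φ.homo b (b B.⁻¹) (a A.⁻¹)))
                                 (A.trans (φ.⟦⟧-cong (B.inverseʳ b) (a A.⁻¹))
                                          (φ.ε-homo (a A.⁻¹)))))
                                 (A.inverseʳ a)
                             , B.inverseʳ b)
      ; ⁻¹-cong = λ (p , q) → act-cong (B.⁻¹-cong q) (A.⁻¹-cong p) , B.⁻¹-cong q
      }
    }
    where
    act-cong : ∀ {b₁ b₂ a₁ a₂} → b₁ B.≈ b₂ → a₁ A.≈ a₂ →
               to (φ b₁) a₁ A.≈ to (φ b₂) a₂
    act-cong {b₁} {b₂} {a₁} {a₂} q r =
      A.trans (⟦⟧-cong (φ b₁) r) (φ.⟦⟧-cong q a₂)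

record AbelianByCyclic (G : Group c ℓ) : Set (lsuc (c ⊔ ℓ)) where
  field
    A        : AbelianGroup c ℓ
    ∣A∣      : ℕ
    A-order  : HasOrder (AbelianGroup.group A) ∣A∣
    C        : Group c ℓ
    m        : ℕ
    C-order  : HasOrder C m
    C-cyclic : IsCyclic C
    φ        : Group.Carrier C → Automorphism (AbelianGroup.group A)
    φ-hom    : IsHom C (Aut (AbelianGroup.group A)) φ
    iso      : Isomorphic ((AbelianGroup.group A ⋊ C) φ φ-hom) G

Word : ℕ → Set
Word w = Fin (2 ^ w)

toWord : ∀ w → ℕ → Word w
toWord w k = _mod_ k (2 ^ w) {{m^n≢0 2 w}}

bits : ∀ w → Word w → Fin w → Bool
bits w x = Inverse.to 2↔Bool ∘ finToFun x

fromBits : ∀ w → (Fin w → Bool) → Word w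
fromBits w f = funToFin (Inverse.from 2↔Bool ∘ f)

data UnOp : Set where
  copy complement reverse : UnOp

data BinOp : Set where
  add sub mul quo rem and or xor shl shr lt eq : BinOp

unop : ∀ w → UnOp → Word w → Word w
unop w copy       x = x
unop w complement x = fromBits w (not ∘ bits w x)
unop w reverse    x = fromBits w (bits w x ∘ opposite)

-- Arithmetic is modulo 2 ^ w; division by zero gives 0.

quotℕ remℕ : ℕ → ℕ → ℕ
quotℕ x zero      = 0
quotℕ x d@(suc _) = x / d
remℕ  x zero      = 0
remℕ  x d@(suc _) = x % d

bool : Bool → ℕ
bool t = if t then 1 else 0

binop : ∀ w → BinOp → Word w → Word w → Word w
binop w add x y = toWord w (toℕ x + toℕ y)
binop w sub x y = toWord w (2 ^ w + toℕ x ∸ toℕ y)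
binop w mul x y = toWord w (toℕ x * toℕ y)
binop w quo x y = toWord w (quotℕ (toℕ x) (toℕ y))
binop w rem x y = toWord w (remℕ (toℕ x) (toℕ y))
binop w and x y = fromBits w λ i → bits w x i ∧ bits w y i
binop w or  x y = fromBits w λ i → bits w x i ∨ bits w y i
binop w xor x y = fromBits w λ i → bits w x i ⊕ bits w y i
binop w shl x y = toWord w (toℕ x * 2 ^ toℕ y)
binop w shr x y = toWord w (quotℕ (toℕ x) (2 ^ toℕ y))
binop w lt  x y = toWord w (bool (toℕ x <ᵇ toℕ y))
binop w eq  x y = toWord w (bool (toℕ x ≡ᵇ toℕ y))

-- A random access machine with k registers and M memory cells of w bits each.
-- Programs mention neither w nor M.

data Instr (k : ℕ) : Set where
  const      : (d : Fin k) → ℕ → Instr k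
  unary      : (d : Fin k) → UnOp → Fin k → Instr k
  binary     : (d : Fin k) → BinOp → Fin k → Fin k → Instr k
  load       : (d addr : Fin k) → Instr k
  store      : (addr s : Fin k) → Instr k
  jump       : ℕ → Instr k
  jumpIfZero : Fin k → ℕ → Instr k

record State (k w M : ℕ) : Set where
  constructor ⟨_,_,_⟩
  field
    pc   : ℕ
    regs : Vec (Word w) k
    mem  : Vec (Word w) M

open State public

-- `nothing` is a fault: an address outside the memory.

locate : ∀ w M → Word w → Maybe (Fin M)
locate w M x with toℕ x <? M
... | yes x<M = just (fromℕ< x<M)
... | no  _   = nothing

step : ∀ {k w M} → Instr k → State k w M → Maybe (State k w M)
step {w = w} (const d n) ⟨ p , R , μ ⟩ =
  just ⟨ suc p , R [ d ]≔ toWord w n , μ ⟩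
step {w = w} (unary d f x) ⟨ p , R , μ ⟩ =
  just ⟨ suc p , R [ d ]≔ unop w f (lookup R x) , μ ⟩
step {w = w} (binary d f x y) ⟨ p , R , μ ⟩ =
  just ⟨ suc p , R [ d ]≔ binop w f (lookup R x) (lookup R y) , μ ⟩
step {w = w} {M} (load d x) ⟨ p , R , μ ⟩ =
  locate w M (lookup R x) >>= λ i → just ⟨ suc p , R [ d ]≔ lookup μ i , μ ⟩
step {w = w} {M} (store x s) ⟨ p , R , μ ⟩ =
  locate w M (lookup R x) >>= λ i → just ⟨ suc p , R , μ [ i ]≔ lookup R s ⟩
step (jump q) ⟨ p , R , μ ⟩ = just ⟨ q , R , μ ⟩
step (jumpIfZero x q) ⟨ p , R , μ ⟩ =
  just ⟨ (if toℕ (lookup R x) ≡ᵇ 0 then q else suc p) , R , μ ⟩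

-- The machine halts when the program counter leaves the program. The result
-- is `just` the final state iff it halts, without a fault, after executing
-- at most t instructions.

run : ∀ {k w M} → List (Instr k) → (t : ℕ) → State k w M → Maybe (State k w M)
run P zero    σ = maybe (λ _ → nothing) (just σ) (head (drop (pc σ) P))
run P (suc t) σ = maybe (λ I → step I σ >>= run P t) (just σ) (head (drop (pc σ) P))

-- Labels are tuples of labelWords words. A query finds the two labels in the
-- first 2 * labelWords registers and leaves the answer in the first labelWords.

record QueryProgram : Set where
  field
    labelWords   : ℕ
    scratchWords : ℕ

  registers : ℕ
  registers = labelWords + (labelWords + scratchWords)

  field
    code : List (Instr registers)

-- Words of κ · ⌈log₂ (1 + n)⌉ bits; for κ ≥ 1 such a word can hold the value n.

wordSize : (κ n : ℕ) → ℕ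
wordSize κ n = κ * ⌈log₂ suc n ⌉

-- The memory consists of the compressed form followed by working space. Nothing
-- is assumed about the working space and the scratch registers at the start of a
-- query, and a query must leave the compressed form intact, so that any sequence
-- of queries can be answered.

record Representation (Q : QueryProgram) (w T : ℕ) (G : Group c ℓ) : Set (c ⊔ ℓ) where
  open Group G
  open QueryProgram Q
  field
    formWords       : ℕ
    workWords       : ℕ
    compressed      : Vec (Word w) formWords
    label           : Carrier → Vec (Word w) labelWords
    label-cong      : ∀ {x y} → x ≈ y → label x ≡ label y
    label-injective : ∀ {x y} → label x ≡ label y → x ≈ y
    multiply        : ∀ x y (scratch : Vec (Word w) scratchWords)
                      (work : Vec (Word w) workWords) →
                      ∃ λ (σ : State registers w (formWords + workWords)) →
                        run code T ⟨ 0 , label x ++ (label y ++ scratch)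
                                       , compressed ++ work ⟩ ≡ just σ
                        × take labelWords (regs σ) ≡ label (x ∙ y)
                        × take formWords (mem σ) ≡ compressed

  space : ℕ
  space = formWords + workWords + registers

{-# OPTIONS --safe #-}
module Submission where

open import Defs
open import Algebra.Bundles using (Group; AbelianGroup; RawGroup)
open import Algebra.Core using (Op₁; Op₂)
import Algebra.Morphism.GroupMonomorphism as GroupMonomorphism
open import Algebra.Morphism.Structures using (module GroupMorphisms)
import Algebra.Properties.CommutativeSemigroup as CommutativeSemigroupProperties
import Algebra.Properties.Group as GroupProperties
import Algebra.Properties.Monoid.Mult as Mult
open import Algebra.Structures using (IsAbelianGroup)
open import Data.Fin using (#_)
open import Data.Fin.Base using (Fin; toℕ; fromℕ<; zero; suc; remQuot; combine)
open import Data.Fin.Properties as Fin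
  using (toℕ<n; toℕ-injective; toℕ-fromℕ<; fromℕ<-toℕ; fromℕ<-cong; toℕ-combine; combine-remQuot;
         remQuot-combine; pigeonhole; injective⇒≤; any?)
open import Data.Integer.Base as ℤ using (-[1+_])
open import Data.List.Base as List
  using (List; []; _∷_; _++_; drop; length; concat; allFin; applyUpTo; deduplicate)
open import Data.List.Membership.Propositional using (_∈_; find)
open import Data.List.Membership.Propositional.Properties
  using (∈-allFin; ∈-lookup; ∈-map⁺; ∈-∃++; ∈-applyUpTo⁻)
import Data.List.Membership.Setoid.Properties as Membership
open import Data.List.Properties using (drop-drop; concat-++; length-applyUpTo; lookup-applyUpTo)
import Data.List.Relation.Unary.All as All
import Data.List.Relation.Unary.All.Properties as All
open import Data.List.Relation.Unary.AllPairs as AllPairs using (AllPairs; []; _∷_)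
import Data.List.Relation.Unary.AllPairs.Properties as AllPairs
open import Data.List.Relation.Unary.Any as Any using (Any)
open import Data.List.Relation.Unary.Any.Properties using (lookup-index)
open import Data.List.Relation.Unary.Unique.DecSetoid.Properties using (deduplicate-!)
open import Data.List.Relation.Unary.Unique.Propositional using (Unique)
open import Data.List.Relation.Unary.Unique.Propositional.Properties using (applyUpTo⁺₁; concat⁺)
open import Data.Maybe.Base using (just; _>>=_)
open import Data.Nat.Base hiding (_⊔_)
open import Data.Nat.DivMod
open import Data.Nat.GeneralisedArithmetic using (fold; fold-+)
open import Data.Nat.Induction using (<-rec)
open import Data.Nat.Logarithm using (⌈log₂_⌉; ⌈log₂⌉-mono-≤; ⌈log₂⌈n/2⌉⌉≡⌈log₂n⌉∸1)
open import Data.Nat.Properties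
open import Data.Nat.Solver using (module +-*-Solver)
open import Data.Product.Base using (∃; Σ-syntax; ∃-syntax; _×_; _,_; proj₁; proj₂; uncurry)
open import Data.Sum.Base using (inj₁; inj₂)
open import Data.Vec.Base as Vec using (Vec; []; _∷_; lookup; map; tabulate; take; _[_]≔_)
open import Data.Vec.Properties
  using (lookup-map; map-[]≔; map-∘; map-id; map-cong; lookup∘tabulate; lookup∘update;
         lookup∘update′; lookup-++-<; ∷-injective; ++-injectiveˡ; take++drop≡id)
open import Function.Base using (_∘_)
open import Function.Bundles using (Inverse)
open import Function.Definitions using (Injective)
open import Level using (0ℓ; _⊔_)
open import Relation.Binary.Bundles using (DecSetoid)
open import Relation.Binary.Definitions
  using (Decidable; Symmetric; Transitive; tri<; tri≈; tri>)
open import Relation.Binary.PropositionalEquality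
open import Relation.Binary.Structures using (IsDecEquivalence)
open import Relation.Nullary using (¬_; Dec; yes; no; contradiction)
open import Relation.Nullary.Decidable
  using (map′; ¬?; decidable-stable; False; toWitnessFalse)
import Relation.Unary as Unary

-- The label of (a , gᵏ) is an index of a ∈ A together with k modulo the order
-- of the generator g. In the product (a + αᵏ(b) , gᵏ⁺ˡ), where α is the action
-- of g, two tables of O(|A|) words are needed.
--
-- Action: write the cycles of α one after another into an array of |A| cells.
-- Knowing the start and the length of the cycle of b and the position of b in
-- it, αᵏ(b) is found by one addition modulo that length.
--
-- Addition: adjoining elements one by one, choose a subgroup B and an element
-- h with |B|² ≤ |A| ≤ |⟨ B , h ⟩|². Let n be the least positive number with
-- n h ∈ B, and write a = r + z h + b with r a representative of a coset of
-- ⟨ B , h ⟩, z < n and b ∈ B. There are at most √|A| representatives and at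
-- most √|A| elements of B, so full tables r + r′ and b + b′ fit into |A|
-- cells, and the multiples of h are added by arithmetic modulo n, the carry
-- being a small multiple of n h ∈ B.

-- Straight-line programs

module StraightLine (w : ℕ) where

  private
    instance
      2^w≢0 : NonZero (2 ^ w)
      2^w≢0 = m^n≢0 2 w

  toℕ-toWord : ∀ a → toℕ (toWord w a) ≡ a % 2 ^ w
  toℕ-toWord a = toℕ-fromℕ< (m%n<n a (2 ^ w))

  toℕ-toWord-< : ∀ {a} → a < 2 ^ w → toℕ (toWord w a) ≡ a
  toℕ-toWord-< a< = trans (toℕ-toWord _) (m<n⇒m%n≡m a<)

  toWord-toℕ : (x : Word w) → toWord w (toℕ x) ≡ x
  toWord-toℕ x = toℕ-injective (toℕ-toWord-< (toℕ<n x))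

  toWord-cong-% : ∀ {a b} → a % 2 ^ w ≡ b % 2 ^ w → toWord w a ≡ toWord w b
  toWord-cong-% q≡ = fromℕ<-cong _ _ q≡ _ _

  toWord-+ : ∀ a b → binop w add (toWord w a) (toWord w b) ≡ toWord w (a + b)
  toWord-+ a b = toWord-cong-% (trans
    (cong₂ (λ x y → (x + y) % 2 ^ w) (toℕ-toWord a) (toℕ-toWord b))
    (sym (%-distribˡ-+ a b (2 ^ w))))

  toWord-* : ∀ a b → binop w mul (toWord w a) (toWord w b) ≡ toWord w (a * b)
  toWord-* a b = toWord-cong-% (trans
    (cong₂ (λ x y → (x * y) % 2 ^ w) (toℕ-toWord a) (toℕ-toWord b))
    (sym (%-distribˡ-* a b (2 ^ w))))

  toWord-/ : ∀ {a b} .{{_ : NonZero b}} → a < 2 ^ w → b < 2 ^ w →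
             binop w quo (toWord w a) (toWord w b) ≡ toWord w (a / b)
  toWord-/ {b = suc _} a< b< =
    cong (toWord w) (cong₂ quotℕ (toℕ-toWord-< a<) (toℕ-toWord-< b<))

  toWord-% : ∀ {a b} .{{_ : NonZero b}} → a < 2 ^ w → b < 2 ^ w →
             binop w rem (toWord w a) (toWord w b) ≡ toWord w (a % b)
  toWord-% {b = suc _} a< b< =
    cong (toWord w) (cong₂ remℕ (toℕ-toWord-< a<) (toℕ-toWord-< b<))

  locate-toWord : ∀ {M a} → a < 2 ^ w → (a<M : a < M) →
                  locate w M (toWord w a) ≡ just (fromℕ< a<M)
  locate-toWord {M} {a} a< a<M with toℕ (toWord w a) <? M
  ... | yes p = cong just (fromℕ<-cong _ _ (toℕ-toWord-< a<) p a<M)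
  ... | no ¬p = contradiction (subst (_< M) (sym (toℕ-toWord-< a<)) a<M) ¬p

  -- Straight-line execution with registers holding natural numbers; the machine
  -- sees them modulo 2 ^ w, so only division, remainder and addresses need bounds.

  data Exec {k M} (μ : Vec (Word w) M) : List (Instr k) → Vec ℕ k → Vec ℕ k → Set where
    done   : ∀ {R} → Exec μ [] R R
    constᴱ : ∀ {P R R′ d n} → Exec μ P (R [ d ]≔ n) R′ → Exec μ (const d n ∷ P) R R′
    addᴱ   : ∀ {P R R′ d x y} v → lookup R x + lookup R y ≡ v →
             Exec μ P (R [ d ]≔ v) R′ → Exec μ (binary d add x y ∷ P) R R′
    mulᴱ   : ∀ {P R R′ d x y} v → lookup R x * lookup R y ≡ v →
             Exec μ P (R [ d ]≔ v) R′ → Exec μ (binary d mul x y ∷ P) R R′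
    quoᴱ   : ∀ {P R R′ d x y} a b .{{_ : NonZero b}} → lookup R x ≡ a → lookup R y ≡ b →
             a < 2 ^ w → b < 2 ^ w → Exec μ P (R [ d ]≔ a / b) R′ →
             Exec μ (binary d quo x y ∷ P) R R′
    remᴱ   : ∀ {P R R′ d x y} a b .{{_ : NonZero b}} → lookup R x ≡ a → lookup R y ≡ b →
             a < 2 ^ w → b < 2 ^ w → Exec μ P (R [ d ]≔ a % b) R′ →
             Exec μ (binary d rem x y ∷ P) R R′
    loadᴱ  : ∀ {P R R′ d x v} → lookup R x < 2 ^ w → (p : lookup R x < M) →
             lookup μ (fromℕ< p) ≡ toWord w v →
             Exec μ P (R [ d ]≔ v) R′ → Exec μ (load d x ∷ P) R R′

  module _ {k M} (μ : Vec (Word w) M) (code : List (Instr k)) where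

    private
      state : ℕ → Vec ℕ k → State k w M
      state p R = ⟨ p , map (toWord w) R , μ ⟩

      next : ∀ {p I P} → drop p code ≡ I ∷ P → drop (suc p) code ≡ P
      next {p} q≡ = trans (cong (λ q → drop q code) (+-comm 1 p))
        (trans (sym (drop-drop p 1 code)) (cong (drop 1) q≡))

      step-binary : ∀ {p R d f x y v} →
        binop w f (toWord w (lookup R x)) (toWord w (lookup R y)) ≡ toWord w v →
        step (binary d f x y) (state p R) ≡ just (state (suc p) (R [ d ]≔ v))
      step-binary {p} {R} {d} {f} {x} {y} {v} q≡ = cong (λ ρ → just ⟨ suc p , ρ , μ ⟩)
        (trans (cong (map (toWord w) R [ d ]≔_) (trans
          (cong₂ (binop w f) (lookup-map x (toWord w) R) (lookup-map y (toWord w) R)) q≡))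
          (sym (map-[]≔ (toWord w) R d)))

    -- `P` is the part of `code` still to be executed, so each of its instructions uses one unit of
    -- time and running off its end halts the machine.
    run-Exec : ∀ {P p R R′} → drop p code ≡ P → Exec μ P R R′ →
               ∃ λ q → run code (length P) (state p R) ≡ just (state q R′)

    private
      continue : ∀ {I P p q R S} {R′ : Vec ℕ k} → drop p code ≡ I ∷ P →
        step I (state p R) ≡ just (state (suc p) S) →
        run code (length P) (state (suc p) S) ≡ just (state q R′) →
        run code (suc (length P)) (state p R) ≡ just (state q R′)
      continue q≡ s r rewrite q≡ | s = r

    run-Exec q≡ done rewrite q≡ = _ , refl
    run-Exec {p = p} {R = R} q≡ (constᴱ {d = d} {n} e) with q , r ← run-Exec (next {p} q≡) e =
      q , continue {S = R [ d ]≔ n} q≡ (cong (λ ρ → just ⟨ suc p , ρ , μ ⟩) (sym (map-[]≔ _ R d))) r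
    run-Exec {p = p} {R = R} q≡ (addᴱ {x = x} {y} v s e) with q , r ← run-Exec (next {p} q≡) e =
      q , continue q≡ (step-binary {R = R} {f = add} {x = x} {y = y}
        (trans (toWord-+ (lookup R x) (lookup R y)) (cong (toWord w) s))) r
    run-Exec {p = p} {R = R} q≡ (mulᴱ {x = x} {y} v s e) with q , r ← run-Exec (next {p} q≡) e =
      q , continue q≡ (step-binary {R = R} {f = mul} {x = x} {y = y}
        (trans (toWord-* (lookup R x) (lookup R y)) (cong (toWord w) s))) r
    run-Exec {p = p} {R = R} q≡ (quoᴱ {x = x} {y} a b refl refl x< y< e)
      with q , r ← run-Exec (next {p} q≡) e =
      q , continue q≡ (step-binary {R = R} {f = quo} {x = x} {y = y} (toWord-/ x< y<)) r
    run-Exec {p = p} {R = R} q≡ (remᴱ {x = x} {y} a b refl refl x< y< e)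
      with q , r ← run-Exec (next {p} q≡) e =
      q , continue q≡ (step-binary {R = R} {f = rem} {x = x} {y = y} (toWord-% x< y<)) r
    run-Exec {p = p} {R = R} q≡ (loadᴱ {d = d} {x} {v} x< x<M m e)
      with q , r ← run-Exec (next {p} q≡) e =
      q , continue {S = R [ d ]≔ v} q≡ (trans
        (cong (_>>= λ i → just ⟨ suc p , map (toWord w) R [ d ]≔ lookup μ i , μ ⟩) (trans
          (cong (locate w M) (lookup-map x (toWord w) R)) (locate-toWord x< x<M)))
        (cong (λ ρ → just ⟨ suc p , ρ , μ ⟩) (trans
          (cong (map (toWord w) R [ d ]≔_) m) (sym (map-[]≔ (toWord w) R d))))) r

-- Iteration and finite sets

least : ∀ {P : ℕ → Set} → Unary.Decidable P → ∀ n → P n →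
        ∃ λ m → P m × (∀ {j} → j < m → ¬ P j)
least P? zero    p = 0 , p , λ ()
least P? (suc n) p with P? 0
... | yes p₀ = 0 , p₀ , λ ()
... | no ¬p₀ with m , pm , below ← least (P? ∘ suc) n p =
  suc m , pm , λ { {zero} _ → ¬p₀ ; {suc j} (s≤s j<m) → below j<m }

module _ {A : Set} {f : A → A} where

  fold-injective : Injective _≡_ _≡_ f → ∀ {a b} n → fold a f n ≡ fold b f n → a ≡ b
  fold-injective inj zero    q≡ = q≡
  fold-injective inj (suc n) q≡ = fold-injective inj n (inj q≡)

  -- Injectivity cancels `i` applications of `f` on both sides, which leaves a return to `a` after j
  -- - i steps. The bound by `j` serves to contradict the minimality of a period.
  fold-cancel : Injective _≡_ _≡_ f → ∀ {a i j} → i < j →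
                fold a f i ≡ fold a f j → ∃ λ d → fold a f (suc d) ≡ a × suc d ≤ j
  fold-cancel inj {a} {i} {j} i<j q≡ with d , refl ← m≤n⇒∃[o]m+o≡n i<j =
    d , sym (fold-injective inj i
          (trans q≡ (trans (cong (fold a f) (sym (+-suc i d))) (fold-+ a f i))))
      , s≤s (m≤n+m d i)

  fold-cycle : ∀ {a n} → fold a f n ≡ a → ∀ k → fold a f (k * n) ≡ a
  fold-cycle         q≡ zero    = refl
  fold-cycle {a} {n} q≡ (suc k) =
    trans (fold-+ a f n) (trans (cong (λ b → fold b f n) (fold-cycle q≡ k)) q≡)

  fold-% : ∀ {a} n .{{_ : NonZero n}} → fold a f n ≡ a → ∀ k → fold a f (k % n) ≡ fold a f k
  fold-% {a} n q≡ k = sym (trans (cong (fold a f) (m≡m%n+[m/n]*n k n))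
    (trans (fold-+ a f (k % n)) (cong (λ b → fold b f (k % n)) (fold-cycle q≡ (k / n)))))

module Period {N : ℕ} (f : Fin N → Fin N) (inj : Injective _≡_ _≡_ f) (a : Fin N) where

  private
    returns : ∃ λ d → fold a f (suc d) ≡ a
    -- Among N + 1 iterates two coincide, and because `f` is injective the sequence comes back to
    -- `a` itself.
    returns with i , j , i<j , q≡ ← pigeonhole ≤-refl (λ (k : Fin (suc N)) → fold a f (toℕ k))
            with d , r , _ ← fold-cancel inj i<j q≡ = d , r

    first : ∃ λ d → fold a f (suc d) ≡ a × (∀ {j} → j < d → ¬ fold a f (suc j) ≡ a)
    first with d , r ← returns = least (λ k → fold a f (suc k) Fin.≟ a) d r

  abstract
    period : ℕ
    period = suc (proj₁ first)

    period≢0 : NonZero period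
    period≢0 = _

    fold-period : fold a f period ≡ a
    fold-period = proj₁ (proj₂ first)

    -- A coincidence would give a return to `a` in at most `j` steps, fewer than the least possible
    -- number.
    fold-distinct : ∀ {i j} → i < j → j < period → fold a f i ≢ fold a f j
    fold-distinct i<j j<p q≡ with d , r , d<j ← fold-cancel inj i<j q≡ =
      proj₂ (proj₂ first) (≤-trans d<j (s≤s⁻¹ j<p)) r

  fold-unique : ∀ {i j} → i < period → j < period → fold a f i ≡ fold a f j → i ≡ j
  fold-unique {i} {j} i<p j<p q≡ with <-cmp i j
  ... | tri< i<j _ _ = contradiction q≡ (fold-distinct i<j j<p)
  ... | tri≈ _ i≡j _ = i≡j
  ... | tri> _ _ j<i = contradiction (sym q≡) (fold-distinct j<i i<p)

  period≤N : period ≤ N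
  period≤N = injective⇒≤ {f = λ (k : Fin period) → fold a f (toℕ k)} λ {i} {j} q≡ →
    toℕ-injective (fold-unique (toℕ<n i) (toℕ<n j) q≡)

lookup-injective : ∀ {A : Set} {_~_ : A → A → Set} → Symmetric _~_ →
  ∀ {xs} → AllPairs (λ x y → ¬ x ~ y) xs →
  ∀ {i j} → List.lookup xs i ~ List.lookup xs j → i ≡ j
lookup-injective ~-sym (x ∷ xs) {zero}  {zero}  r = refl
lookup-injective ~-sym (x ∷ xs) {zero}  {suc j} r = contradiction r (All.lookup x (∈-lookup j))
lookup-injective ~-sym (x ∷ xs) {suc i} {zero}  r =
  contradiction (~-sym r) (All.lookup x (∈-lookup i))
lookup-injective ~-sym (x ∷ xs) {suc i} {suc j} r = cong suc (lookup-injective ~-sym xs r)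

Unique⇒length≤ : ∀ {N} {xs : List (Fin N)} → Unique xs → length xs ≤ N
Unique⇒length≤ xs! = injective⇒≤ (lookup-injective sym xs!)

-- Serves twice: the classes are first the cycles of a permutation and later the cosets of a
-- subgroup.
module Transversal {N : ℕ} {_~_ : Fin N → Fin N → Set} (isDec : IsDecEquivalence _~_) where
  private
    S : DecSetoid 0ℓ 0ℓ
    S = record { isDecEquivalence = isDec }
    open DecSetoid S using ()
      renaming (setoid to ~-setoid; _≟_ to _~?_; refl to ~-refl; sym to ~-sym; trans to ~-trans)

  abstract
    representatives : List (Fin N)
    representatives = deduplicate _~?_ (allFin N)

    representatives-! : AllPairs (λ a b → ¬ a ~ b) representatives
    representatives-! = deduplicate-! S (allFin N)

    represented : ∀ a → Any (a ~_) representatives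
    represented a = Membership.∈-deduplicate⁺ ~-setoid _~?_ (λ p q → ~-trans q (~-sym p))
      (Any.map (λ { refl → ~-refl }) (∈-allFin a))

abstract
  -- The machine indexes by numbers, so the function is extended to all of ℕ. The value 0 merely
  -- fills the cells past the end.
  table : ∀ {p} → (Fin p → ℕ) → ℕ → ℕ
  table {p} f x with x <? p
  ... | yes x<p = f (fromℕ< x<p)
  ... | no  _   = 0

  table-toℕ : ∀ {p} (f : Fin p → ℕ) i → table f (toℕ i) ≡ f i
  table-toℕ {p} f i with toℕ i <? p
  ... | yes i<p = cong f (fromℕ<-toℕ i i<p)
  ... | no  i≮p = contradiction (toℕ<n i) i≮p

-- Cycles of a permutation

lookup-block : ∀ {A : Set} (xs ys zs : List A) (j : Fin (length ys)) →
  ∃ λ (i : Fin (length (xs ++ ys ++ zs))) →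
    toℕ i ≡ length xs + toℕ j × List.lookup (xs ++ ys ++ zs) i ≡ List.lookup ys j
lookup-block []       (y ∷ ys) zs zero    = zero , refl , refl
lookup-block []       (y ∷ ys) zs (suc j) with i , q , r ← lookup-block [] ys zs j =
  suc i , cong suc q , r
lookup-block (x ∷ xs) ys       zs j       with i , q , r ← lookup-block xs ys zs j =
  suc i , cong suc q , r

-- `base` is the first cell of the cycle in the array `orb`. The bounds on `pos` and `len` keep the
-- machine's arithmetic within a word, and `slot<` keeps the computed cell within the table.
record OrbitTables {N : ℕ} (f : Fin N → Fin N) : Set where
  field
    base pos len : Fin N → ℕ
    orb          : ℕ → ℕ
    len≢0        : ∀ a → NonZero (len a)
    pos<         : ∀ a → pos a < N
    len≤         : ∀ a → len a ≤ N
    slot<        : ∀ a k → let instance _ = len≢0 a in base a + (pos a + k) % len a < N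
    orb-slot     : ∀ a k → let instance _ = len≢0 a in
                   orb (base a + (pos a + k) % len a) ≡ toℕ (fold a f k)

module Orbits {N : ℕ} (f : Fin N → Fin N) (inj : Injective _≡_ _≡_ f) where
  open module P a = Period f inj a

  private
    instance
      period-nonZero : ∀ {a} → NonZero (period a)
      period-nonZero = period≢0 _

    _~_ : Fin N → Fin N → Set
    a ~ b = ∃ λ k → fold a f k ≡ b

    -- The number of steps can be reduced modulo the period, so a finite search decides.
    ~-dec : Decidable _~_
    ~-dec a b = map′ (λ (k , q≡) → toℕ k , q≡)
      (λ (k , q≡) → fromℕ< (m%n<n k (period a)) ,
        trans (cong (fold a f) (toℕ-fromℕ< (m%n<n k (period a))))
          (trans (fold-% (period a) (fold-period a) k) q≡))
      (any? {n = period a} (λ k → fold a f (toℕ k) Fin.≟ b))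

    -- After `k` steps, another k (period - 1) steps complete `k` full turns of the cycle.
    ~-sym : Symmetric _~_
    ~-sym {a} (k , refl) = k * pred (period a) ,
      trans (sym (fold-+ a f (k * pred (period a))))
      (trans (cong (fold a f) (trans (+-comm (k * pred (period a)) k)
        (trans (sym (*-suc k _)) (cong (k *_) (suc-pred (period a))))))
      (fold-cycle (fold-period a) k))

    ~-trans : Transitive _~_
    ~-trans {a} (k , refl) (l , refl) = l + k , fold-+ a f l

    ~-isDecEquivalence : IsDecEquivalence _~_
    ~-isDecEquivalence = record
      { isEquivalence = record { refl = 0 , refl ; sym = ~-sym ; trans = ~-trans }
      ; _≟_ = ~-dec }

    open Transversal ~-isDecEquivalence

    orbit : Fin N → List (Fin N)
    orbit a = applyUpTo (fold a f) (period a)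

    orbit-! : ∀ a → Unique (orbit a)
    orbit-! a = applyUpTo⁺₁ (fold a f) (period a) (fold-distinct a)

    ∈orbit⇒~ : ∀ {a b} → b ∈ orbit a → a ~ b
    ∈orbit⇒~ {a} b∈ with k , _ , refl ← ∈-applyUpTo⁻ (fold a f) b∈ = k , refl

    layout : List (Fin N)
    layout = concat (List.map orbit representatives)

    -- Each cycle is listed without repetition, and a common element of two cycles would make their
    -- representatives equivalent. Hence all cycles together fill at most `N` cells.
    layout-! : Unique layout
    layout-! = concat⁺ (All.map⁺ (All.universal orbit-! representatives))
      (AllPairs.map⁺ (AllPairs.map
        (λ r≁s {v} (b∈r , b∈s) → r≁s (~-trans (∈orbit⇒~ b∈r) (~-sym (∈orbit⇒~ b∈s))))
        representatives-!))

    entry : Fin (length layout) → ℕ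
    entry i = toℕ (List.lookup layout i)

    -- `b` is the cell where the cycle of `rep` begins and `p` the number of steps from `rep` to
    -- `a`. The whole cycle is described by `entries`, since iterating from `a` may lead anywhere on
    -- it.
    record Placement (a : Fin N) : Set where
      field
        {rep}  : Fin N
        {b p}  : ℕ
        p<     : p < period rep
        reach  : fold rep f p ≡ a
        entries : ∀ t → t < period rep → ∃ λ (i : Fin (length layout)) →
                 toℕ i ≡ b + t × List.lookup layout i ≡ fold rep f t

    abstract
      placement : ∀ a → Placement a
      placement a with r , r∈ , a~r ← find (represented a)
                  with k , q≡ ← ~-sym a~r
                  -- Splitting the list of cycles at the chosen one determines `b`: the total length
                  -- of the cycles before it.
                  with xss , yss , split ← ∈-∃++ (∈-map⁺ orbit r∈) = record
        { p<     = m%n<n k (period r)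
        ; reach  = trans (fold-% (period r) (fold-period r) k) q≡
        ; entries = λ t t< → let
              j = fromℕ< (subst (t <_) (sym (length-applyUpTo (fold r f) (period r))) t<)
              j≡t = toℕ-fromℕ< (subst (t <_) (sym (length-applyUpTo (fold r f) (period r))) t<)
              in subst (λ xs → ∃ λ (i : Fin (length xs)) →
                   toℕ i ≡ length (concat xss) + t × List.lookup xs i ≡ fold r f t)
                 (trans (concat-++ xss (orbit r ∷ yss)) (cong concat (sym split)))
                 (let i , q , s = lookup-block (concat xss) (orbit r) (concat yss) j in
                  i , trans q (cong (length (concat xss) +_) j≡t)
                    , trans s (trans (lookup-applyUpTo (fold r f) (period r) j)
                        (cong (fold r f) j≡t)))
        }

    module Place a = Placement (placement a)
    open Place

    -- `a` lies `p` steps after `rep`, so `k` steps from `a` are p + k steps from `rep`, and full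
    -- turns may be dropped.
    fold-slot : ∀ a k → fold (rep a) f ((p a + k) % period (rep a)) ≡ fold a f k
    fold-slot a k = trans (fold-% (period (rep a)) (fold-period (rep a)) (p a + k))
      (trans (cong (fold (rep a) f) (+-comm (p a) k))
      (trans (fold-+ (rep a) f k) (cong (λ b → fold b f k) (reach a))))

  orbitTables : OrbitTables f
  orbitTables = record
    { base     = b
    ; pos      = p
    ; len      = λ a → period (rep a)
    ; orb      = table entry
    ; len≢0    = λ a → period≢0 (rep a)
    ; pos<     = λ a → <-≤-trans (p< a) (period≤N (rep a))
    ; len≤     = λ a → period≤N (rep a)
    ; slot<    = λ a k → let i , q , _ = entries a _ (m%n<n (p a + k) (period (rep a))) in
                 subst (_< N) q (<-≤-trans (toℕ<n i) (Unique⇒length≤ layout-!))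
    ; orb-slot = λ a k → let i , q , r = entries a _ (m%n<n (p a + k) (period (rep a))) in
                 trans (cong (table entry) (sym q)) (trans (table-toℕ entry i)
                   (cong toℕ (trans r (fold-slot a k))))
    }

-- Addition in a finite abelian group

-- The triple (`coset`, `height`, `base`) encodes r + z h + b. The sum `s` of two representatives
-- need not be a representative: it is decomposed in turn and contributes a third height and a third
-- base. `carry q` stands for q n h. The three product bounds are the sizes of the tables for `_⊞_`,
-- `sum` and `element`.
record AdditionTables {N : ℕ} (_∙_ : Op₂ (Fin N)) : Set where
  field
    n β γ   : ℕ
    n≢0     : NonZero n
    n≤N     : n ≤ N
    β²≤N    : β * β ≤ N
    γ²≤N    : γ * γ ≤ N
    γnβ≤N   : γ * (n * β) ≤ N
    coset   : Fin N → Fin γ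
    height  : Fin N → Fin n
    base    : Fin N → Fin β
    sum     : Fin γ → Fin γ → Fin N
    _⊞_     : Fin β → Fin β → Fin β
    carry   : ℕ → Fin β
    element : Fin γ → Fin n → Fin β → Fin N

  total : Fin N → Fin N → ℕ
  total a a′ = toℕ (height a) + toℕ (height a′) + toℕ (height (sum (coset a) (coset a′)))

  private instance _ = n≢0

  field
    ∙-tables : ∀ a a′ → let s = sum (coset a) (coset a′) in
      a ∙ a′ ≡ element (coset s) (total a a′ mod n)
                 (((base a ⊞ base a′) ⊞ base s) ⊞ carry (total a a′ / n))

module FiniteAbelian {N : ℕ} {op : Op₂ (Fin N)} {e : Fin N} {inv : Op₁ (Fin N)}
                     (isAbelianGroup : IsAbelianGroup _≡_ op e inv) where

  private
    A : Set
    A = Fin N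

    group : AbelianGroup 0ℓ 0ℓ
    group = record { isAbelianGroup = isAbelianGroup }

  open AbelianGroup group
    using (_∙_; ε; _⁻¹; assoc; comm; identityˡ; identityʳ; inverseʳ; monoid; commutativeSemigroup)
  open GroupProperties (AbelianGroup.group group) using (∙-cancelˡ; inverseʳ-unique; x≈z//y)
  open CommutativeSemigroupProperties commutativeSemigroup using (interchange)
  open Mult monoid using (×-homo-+; ×-assocˡ) renaming (_×_ to _·_)
  open ≡-Reasoning

  -- Translation by `a` is a permutation; its period at `ε` is the required multiple.
  order : ∀ a → ∃ λ k → suc k · a ≡ ε
  order a = pred period ,
    trans (cong (_· a) (suc-pred period)) (trans (sym (fold-· period)) fold-period)
    where
    a∙-injective : Injective _≡_ _≡_ (a ∙_)
    a∙-injective = ∙-cancelˡ a _ _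

    open Period (a ∙_) a∙-injective ε
    instance _ = period≢0

    fold-· : ∀ k → fold ε (a ∙_) k ≡ k · a
    fold-· zero    = refl
    fold-· (suc k) = cong (a ∙_) (fold-· k)

  record Subgroup : Set where
    field
      size           : ℕ
      embed          : Fin size → A
      embed-injective : Injective _≡_ _≡_ embed
      unit           : ∃ λ i → embed i ≡ ε
      closed         : ∀ i j → ∃ λ k → embed k ≡ embed i ∙ embed j

    _∈ˢ : A → Set
    a ∈ˢ = ∃ λ i → embed i ≡ a

    _∈ˢ? : ∀ a → Dec (a ∈ˢ)
    a ∈ˢ? = any? λ i → embed i Fin.≟ a

    infixl 6 _⊞_

    _⊞_ : Fin size → Fin size → Fin size
    i ⊞ j = proj₁ (closed i j)

    embed-⊞ : ∀ i j → embed (i ⊞ j) ≡ embed i ∙ embed j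
    embed-⊞ i j = proj₂ (closed i j)

    ∙-∈ : ∀ {a b} → a ∈ˢ → b ∈ˢ → (a ∙ b) ∈ˢ
    ∙-∈ (i , refl) (j , refl) = closed i j

    ·-∈ : ∀ {a} → a ∈ˢ → ∀ k → (k · a) ∈ˢ
    ·-∈ a∈ zero    = unit
    ·-∈ a∈ (suc k) = ∙-∈ a∈ (·-∈ a∈ k)

    -- If (k + 1) a = ε then k a is the inverse of `a`, so closure under multiples suffices.
    ⁻¹-∈ : ∀ {a} → a ∈ˢ → (a ⁻¹) ∈ˢ
    ⁻¹-∈ {a} a∈ with k , q≡ ← order a = subst _∈ˢ (inverseʳ-unique a (k · a) q≡) (·-∈ a∈ k)

    size≤N : size ≤ N
    size≤N = injective⇒≤ embed-injective

    instance
      size≢0 : NonZero size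
      size≢0 = >-nonZero (≤-<-trans z≤n (toℕ<n (proj₁ unit)))

  trivial : Subgroup
  trivial = record
    { size = 1 ; embed = λ _ → ε ; embed-injective = λ { {zero} {zero} _ → refl }
    ; unit = zero , refl ; closed = λ _ _ → zero , sym (identityˡ ε) }

  module Extension (B : Subgroup) (g : A) where
    open Subgroup B

    private
      first : ∃ λ k → (suc k · g) ∈ˢ × (∀ {j} → j < k → ¬ (suc j · g) ∈ˢ)
      first with k , q≡ ← order g =
        least (λ k → (suc k · g) ∈ˢ?) k (subst _∈ˢ (sym q≡) unit)

    abstract
      n : ℕ
      n = suc (proj₁ first)

      n≢0 : NonZero n
      n≢0 = _

      n·g∈ : (n · g) ∈ˢ
      n·g∈ = proj₁ (proj₂ first)

      j·g∈⇒j≡0 : ∀ {j} → j < n → (j · g) ∈ˢ → j ≡ 0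
      j·g∈⇒j≡0 {zero}  _         _   = refl
      j·g∈⇒j≡0 {suc j} (s≤s j<k) j·g∈ = contradiction j·g∈ (proj₂ (proj₂ first) j<k)

    private instance _ = n≢0

    pair : Fin n → Fin size → A
    pair z i = toℕ z · g ∙ embed i

    carry : ℕ → Fin size
    carry q = proj₁ (·-∈ n·g∈ q)

    -- Divide `k` by `n` with remainder: the part (k / n) n g lies in the subgroup and is absorbed
    -- into the base.
    ·g-reduce : ∀ k i → k · g ∙ embed i ≡ pair (k mod n) (i ⊞ carry (k / n))
    ·g-reduce k i = begin
      k · g ∙ embed i
        ≡⟨ cong (λ l → l · g ∙ embed i) (m≡m%n+[m/n]*n k n) ⟩
      (k % n + k / n * n) · g ∙ embed i
        ≡⟨ cong (_∙ embed i) (×-homo-+ g (k % n) (k / n * n)) ⟩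
      (k % n) · g ∙ (k / n * n) · g ∙ embed i
        ≡⟨ cong (λ x → (k % n) · g ∙ x ∙ embed i)
             (trans (sym (×-assocˡ g (k / n) n)) (sym (proj₂ (·-∈ n·g∈ (k / n))))) ⟩
      (k % n) · g ∙ embed (carry (k / n)) ∙ embed i
        ≡⟨ assoc _ _ _ ⟩
      (k % n) · g ∙ (embed (carry (k / n)) ∙ embed i)
        ≡⟨ cong₂ (λ l x → l · g ∙ x) (sym (toℕ-fromℕ< (m%n<n k n)))
             (trans (comm _ _) (sym (embed-⊞ i (carry (k / n))))) ⟩
      pair (k mod n) (i ⊞ carry (k / n)) ∎

    ·g-add : ∀ k l i j → (k · g ∙ embed i) ∙ (l · g ∙ embed j) ≡ (k + l) · g ∙ embed (i ⊞ j)
    ·g-add k l i j = trans (interchange (k · g) (embed i) (l · g) (embed j))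
      (cong₂ _∙_ (sym (×-homo-+ g k l)) (sym (embed-⊞ i j)))

    private
      -- With z′ = z + d, cancelling z g leaves d g as a difference of two elements of the subgroup.
      -- Since d < n, minimality of `n` forces d = 0.
      pair-≤ : ∀ z i z′ i′ → toℕ z ≤ toℕ z′ → pair z i ≡ pair z′ i′ → z ≡ z′
      pair-≤ z i z′ i′ z≤z′ q≡ with d , z+d≡z′ ← m≤n⇒∃[o]m+o≡n z≤z′ =
        toℕ-injective (trans (sym (+-identityʳ _))
          (trans (cong (toℕ z +_) (sym d≡0)) z+d≡z′))
        where
        embed-i : embed i ≡ d · g ∙ embed i′
        embed-i = ∙-cancelˡ (toℕ z · g) _ _ (begin
          toℕ z · g ∙ embed i              ≡⟨ q≡ ⟩
          toℕ z′ · g ∙ embed i′            ≡⟨ cong (λ l → l · g ∙ embed i′) z+d≡z′ ⟨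
          (toℕ z + d) · g ∙ embed i′       ≡⟨ cong (_∙ embed i′) (×-homo-+ g (toℕ z) d) ⟩
          toℕ z · g ∙ d · g ∙ embed i′     ≡⟨ assoc _ _ _ ⟩
          toℕ z · g ∙ (d · g ∙ embed i′)   ∎)

        d≡0 : d ≡ 0
        d≡0 = j·g∈⇒j≡0 (≤-<-trans (≤-trans (m≤n+m d (toℕ z)) (≤-reflexive z+d≡z′)) (toℕ<n z′))
          (subst _∈ˢ (sym (x≈z//y _ _ _ (sym embed-i))) (∙-∈ (i , refl) (⁻¹-∈ (i′ , refl))))

    pair-injective : ∀ z i z′ i′ → pair z i ≡ pair z′ i′ → z ≡ z′ × i ≡ i′
    pair-injective z i z′ i′ q≡ = z≡z′ , embed-injective (∙-cancelˡ (toℕ z · g) _ _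
        (trans q≡ (cong (λ z → toℕ z · g ∙ embed i′) (sym z≡z′))))
      where
      z≡z′ : z ≡ z′
      z≡z′ with ≤-total (toℕ z) (toℕ z′)
      ... | inj₁ z≤z′ = pair-≤ z i z′ i′ z≤z′ q≡
      ... | inj₂ z′≤z = sym (pair-≤ z′ i′ z i z′≤z (sym q≡))

    split : Fin (n * size) → Fin n × Fin size
    split = remQuot {n} size

    -- The unit and the closure of the extension both reduce to this: any multiple of `g` plus an
    -- element of `B` has a normalised form.
    span : ∀ k i → ∃ λ x → uncurry pair (split x) ≡ k · g ∙ embed i
    span k i = combine (k mod n) (i ⊞ carry (k / n)) ,
      trans (cong (uncurry pair) (remQuot-combine (k mod n) _)) (sym (·g-reduce k i))

    extension : Subgroup
    extension = record
      { size = n * size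
      ; embed = uncurry pair ∘ split
      ; embed-injective = λ {x} {y} q≡ →
          let z≡ , i≡ = pair-injective _ _ _ _ q≡ in
          trans (sym (combine-remQuot {n} size x))
            (trans (cong₂ combine z≡ i≡) (combine-remQuot {n} size y))
      ; unit = let i , i≡ = unit ; x , x≡ = span 0 i in
          x , trans x≡ (trans (cong (ε ∙_) i≡) (identityˡ ε))
      ; closed = λ x y → let z , i = split x ; z′ , i′ = split y
                             w , w≡ = span (toℕ z + toℕ z′) (i ⊞ i′) in
          w , trans w≡ (sym (·g-add (toℕ z) (toℕ z′) i i′))
      }

    -- n = 1 would put `g` into the subgroup, so adjoining a new element at least doubles the size.
    size<extension : ¬ (g ∈ˢ) → size < n * size
    size<extension g∉ = ≤-trans (+-monoˡ-≤ size (>-nonZero⁻¹ size))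
      (≤-trans (≤-reflexive (cong (size +_) (sym (+-identityʳ size)))) (*-monoˡ-≤ size 2≤n))
      where
      2≤n : 2 ≤ n
      2≤n = ≤∧≢⇒< (>-nonZero⁻¹ n) λ 1≡n →
        g∉ (subst _∈ˢ (trans (cong (_· g) (sym 1≡n)) (identityʳ g)) n·g∈)

  open Subgroup

  -- B and ⟨ B , g ⟩ lie on either side of √N.
  record Straddle : Set where
    field
      B        : Subgroup
      g        : A
      B²≤N     : size B * size B ≤ N
      N≤⟨B,g⟩² : let open Extension B g in N ≤ size extension * size extension

  private
    m≤m² : ∀ m → m ≤ m * m
    m≤m² zero      = z≤n
    m≤m² m@(suc _) = m≤m*n m m

    -- The two hypotheses leave only N = 1. Any `g` will then do, as the extension is at least as
    -- large as `B`.
    full : ∀ B → size B * size B ≤ N → N ≤ size B → Straddle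
    full B B²≤N N≤B = record { B = B ; g = ε ; B²≤N = B²≤N
      ; N≤⟨B,g⟩² = ≤-trans (≤-trans N≤B (m≤n*m (size B) n)) (m≤m² (n * size B)) }
      where
      open Extension B ε
      instance _ = n≢0

    -- Elements outside `B` are adjoined until the square of the size reaches `N`. Every adjunction
    -- enlarges `B` strictly and so pays for one unit of fuel.
    search : ∀ fuel B → size B * size B ≤ N → N ≤ size B + fuel → Straddle
    search zero       B B²≤N N≤ = full B B²≤N (≤-trans N≤ (≤-reflexive (+-identityʳ _)))
    search (suc fuel) B B²≤N N≤ with any? (λ a → ¬? (_∈ˢ? B a))
    ... | no  all∈ = full B B²≤N (injective⇒≤ {f = proj₁ ∘ index} λ {a} {b} q≡ →
            trans (sym (proj₂ (index a))) (trans (cong (embed B) q≡) (proj₂ (index b))))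
      where
      index : ∀ a → _∈ˢ B a
      index a = decidable-stable (_∈ˢ? B a) λ a∉ → all∈ (a , a∉)
    ... | yes (g , g∉) with N ≤? size (Extension.extension B g) * size (Extension.extension B g)
    ...   | yes N≤D² = record { B = B ; g = g ; B²≤N = B²≤N ; N≤⟨B,g⟩² = N≤D² }
    ...   | no  N≰D² = search fuel extension (<⇒≤ (≰⇒> N≰D²))
            (≤-trans N≤ (≤-trans (≤-reflexive (+-suc (size B) fuel))
              (+-monoˡ-≤ fuel (size<extension g∉))))
      where open Extension B g

    N≢0 : NonZero N
    N≢0 = >-nonZero (≤-<-trans z≤n (toℕ<n ε))

  abstract
    straddle : Straddle
    straddle = search N trivial (>-nonZero⁻¹ N {{N≢0}}) (n≤1+n N)

  module Cosets (D : Subgroup) where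
    private
      _~_ : A → A → Set
      a ~ b = ∃ λ d → a ∙ embed D d ≡ b

      ~-sym : Symmetric _~_
      ~-sym {a} (d , refl) with d′ , d′≡ ← ⁻¹-∈ D (d , refl) = d′ , (begin
        a ∙ embed D d ∙ embed D d′        ≡⟨ cong (a ∙ embed D d ∙_) d′≡ ⟩
        a ∙ embed D d ∙ embed D d ⁻¹      ≡⟨ assoc _ _ _ ⟩
        a ∙ (embed D d ∙ embed D d ⁻¹)    ≡⟨ cong (a ∙_) (inverseʳ _) ⟩
        a ∙ ε                             ≡⟨ identityʳ a ⟩
        a                                 ∎)

      ~-trans : Transitive _~_
      ~-trans {a} (d , refl) (d′ , refl) = _⊞_ D d d′ ,
        trans (cong (a ∙_) (embed-⊞ D d d′)) (sym (assoc _ _ _))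

      ~-isDecEquivalence : IsDecEquivalence _~_
      ~-isDecEquivalence = record
        { isEquivalence = record
          { refl  = λ {a} → let d , d≡ = unit D in d , trans (cong (a ∙_) d≡) (identityʳ a)
          ; sym   = ~-sym
          ; trans = ~-trans }
        ; _≟_ = λ a b → any? λ d → a ∙ embed D d Fin.≟ b }

    open Transversal ~-isDecEquivalence

    γ : ℕ
    γ = length representatives

    rep : Fin γ → A
    rep = List.lookup representatives

    coset : A → Fin γ
    coset a = Any.index (represented a)

    private
      residue : ∀ a → rep (coset a) ~ a
      residue a = ~-sym (lookup-index (represented a))

    offset : A → Fin (size D)
    offset a = proj₁ (residue a)

    decompose : ∀ a → a ≡ rep (coset a) ∙ embed D (offset a)
    decompose a = sym (proj₂ (residue a))

    -- The map (c , d) ↦ rep c + d is injective: inequivalence of the representatives recovers `c`,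
    -- and cancellation then recovers `d`.
    γ*size≤N : γ * size D ≤ N
    γ*size≤N = injective⇒≤ {f = λ x → let c , d = remQuot {γ} (size D) x in rep c ∙ embed D d}
      λ {x} {y} q≡ → let
        c≡ = lookup-injective ~-sym representatives-! (~-trans (_ , q≡) (~-sym (_ , refl)))
        d≡ = embed-injective D (∙-cancelˡ _ _ _ (trans q≡ (cong (λ c → rep c ∙ _) (sym c≡))))
        in trans (sym (combine-remQuot {γ} (size D) x))
             (trans (cong₂ combine c≡ d≡) (combine-remQuot {γ} (size D) y))

    -- N γ² ≤ |D|² γ² = (γ |D|)² ≤ N², and one factor `N` cancels.
    γ²≤N : N ≤ size D * size D → γ * γ ≤ N
    γ²≤N N≤ = *-cancelˡ-≤ N {{N≢0}} (≤-trans (*-monoˡ-≤ (γ * γ) N≤)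
      (≤-trans (≤-reflexive (solve 2 (λ d c → (d :* d) :* (c :* c) := (c :* d) :* (c :* d))
        refl (size D) γ))
        (*-mono-≤ γ*size≤N γ*size≤N)))
      where open +-*-Solver

  additionTables : AdditionTables op
  additionTables = record
    { n        = n
    ; β        = size B
    ; γ        = γ
    ; n≢0      = n≢0
    ; n≤N      = ≤-trans (m≤m*n n (size B) {{size≢0 B}}) (size≤N extension)
    ; β²≤N     = B²≤N
    ; γ²≤N     = γ²≤N N≤⟨B,g⟩²
    ; γnβ≤N    = γ*size≤N
    ; coset    = coset
    ; height   = height
    ; base     = base
    ; sum      = λ c c′ → rep c ∙ rep c′
    ; _⊞_      = _⊕_
    ; carry    = carry
    ; element  = λ c z i → rep c ∙ pair z i
    ; ∙-tables = λ a a′ → let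
        s = rep (coset a) ∙ rep (coset a′)
        z = toℕ (height a) ; z′ = toℕ (height a′) ; z″ = toℕ (height s)
        i = base a ; i′ = base a′ ; i″ = base s
      in begin
        a ∙ a′
          ≡⟨ cong₂ _∙_ (decompose a) (decompose a′) ⟩
        (rep (coset a) ∙ pair (height a) i) ∙ (rep (coset a′) ∙ pair (height a′) i′)
          ≡⟨ interchange _ _ _ _ ⟩
        s ∙ (pair (height a) i ∙ pair (height a′) i′)
          ≡⟨ cong₂ _∙_ (decompose s) (·g-add z z′ i i′) ⟩
        (rep (coset s) ∙ pair (height s) i″) ∙ ((z + z′) · g ∙ embed B (i ⊕ i′))
          ≡⟨ assoc _ _ _ ⟩
        rep (coset s) ∙ (pair (height s) i″ ∙ ((z + z′) · g ∙ embed B (i ⊕ i′)))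
          ≡⟨ cong (rep (coset s) ∙_) (trans (comm _ _) (·g-add (z + z′) z″ (i ⊕ i′) i″)) ⟩
        rep (coset s) ∙ ((z + z′ + z″) · g ∙ embed B ((i ⊕ i′) ⊕ i″))
          -- All three heights have been added before this single reduction modulo `n`, so only one
          -- carry arises.
          ≡⟨ cong (rep (coset s) ∙_) (·g-reduce (z + z′ + z″) ((i ⊕ i′) ⊕ i″)) ⟩
        rep (coset s) ∙ pair ((z + z′ + z″) mod n) (((i ⊕ i′) ⊕ i″) ⊕ carry ((z + z′ + z″) / n)) ∎
    }
    where
    open Straddle straddle
    open Extension B g
    open Cosets extension
    instance _ = n≢0
    _⊕_ = _⊞_ B
    height : A → Fin n
    height a = proj₁ (split (offset a))
    base : A → Fin (size B)
    base a = proj₂ (split (offset a))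

-- Coordinates on the group

module Finite {c ℓ} {G : Group c ℓ} {n} (order : HasOrder G n) where
  open Group G renaming (refl to ≈-refl; sym to ≈-sym; trans to ≈-trans)
  open Inverse order public using () renaming (to to index; from to enum)

  index-cong : ∀ {x y} → x ≈ y → index x ≡ index y
  index-cong = Inverse.to-cong order

  enum-cong : ∀ {i j} → i ≡ j → enum i ≈ enum j
  enum-cong = Inverse.from-cong order

  index-enum : ∀ i → index (enum i) ≡ i
  index-enum = Inverse.strictlyInverseˡ order

  enum-index : ∀ x → enum (index x) ≈ x
  enum-index = Inverse.strictlyInverseʳ order

  index-injective : ∀ {x y} → index x ≡ index y → x ≈ y
  index-injective {x} {y} p = ≈-trans (≈-sym (enum-index x)) (≈-trans (enum-cong p) (enum-index y))

  enum-injective : ∀ {i j} → enum i ≈ enum j → i ≡ j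
  enum-injective {i} {j} p = trans (sym (index-enum i)) (trans (index-cong p) (index-enum j))

module _ {a b ℓ₁ ℓ₂} {H : Group a ℓ₁} {G : Group b ℓ₂} {m n} (H-order : HasOrder H m)
         (G-order : HasOrder G n) where
  private
    module H = Finite {G = H} H-order
    module G = Finite {G = G} G-order

  order≤ : (f : Group.Carrier H → Group.Carrier G) →
           (∀ {x y} → Group._≈_ G (f x) (f y) → Group._≈_ H x y) → m ≤ n
  order≤ f f-inj = injective⇒≤ {f = G.index ∘ f ∘ H.enum}
    λ p → H.enum-injective (f-inj (G.index-injective p))

module Logarithm {c ℓ} (C : Group c ℓ) {m} (order : HasOrder C m) (cyclic : IsCyclic C) where
  open Group C renaming (refl to ≈-refl; sym to ≈-sym; trans to ≈-trans)
  open GroupProperties C using (∙-cancelˡ; inverseˡ-unique)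
  open Finite {G = C} order

  generator : Carrier
  generator = proj₁ cyclic

  private
    g : Carrier
    g = generator

    next : Fin m → Fin m
    next i = index (g ∙ enum i)

    fold-next : ∀ k → fold (index ε) next k ≡ index (pow C g k)
    fold-next zero    = refl
    fold-next (suc k) = index-cong (∙-congˡ (≈-trans (enum-cong (fold-next k)) (enum-index _)))

    next-injective : Injective _≡_ _≡_ next
    next-injective p = enum-injective (∙-cancelˡ g _ _ (index-injective p))

    module P = Period next next-injective (index ε)

  -- The order of the generator, obtained as the length of the cycle of the unit under
  -- multiplication by it.
  o : ℕ
  o = P.period

  o≢0 : NonZero o
  o≢0 = P.period≢0

  o≤m : o ≤ m
  o≤m = P.period≤N

  private instance _ = o≢0

  pow-+ : ∀ k l → pow C g (k + l) ≈ pow C g k ∙ pow C g l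
  pow-+ zero    l = ≈-sym (identityˡ _)
  pow-+ (suc k) l = ≈-trans (∙-congˡ (pow-+ k l)) (≈-sym (assoc g _ _))

  pow-% : ∀ k → pow C g (k % o) ≈ pow C g k
  pow-% k = index-injective (trans (sym (fold-next (k % o)))
    (trans (fold-% o P.fold-period k) (fold-next k)))

  pow-cycle : ∀ k → pow C g (k * o) ≈ ε
  pow-cycle k = index-injective (trans (sym (fold-next (k * o))) (fold-cycle P.fold-period k))

  pow-unique : ∀ {k l} → k < o → l < o → pow C g k ≈ pow C g l → k ≡ l
  pow-unique {k} {l} k<o l<o p = P.fold-unique k<o l<o
    (trans (fold-next k) (trans (index-cong p) (sym (fold-next l))))

  private
    -- k (o - 1) + k = k o, and the power k o is trivial. This turns negative exponents into natural
    -- ones.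
    pow-⁻¹ : ∀ k → pow C g (k * pred o) ≈ pow C g k ⁻¹
    pow-⁻¹ k = inverseˡ-unique _ _ (≈-trans (≈-sym (pow-+ (k * pred o) k))
      (≈-trans (reflexive (cong (pow C g) (trans (+-comm (k * pred o) k)
        (trans (sym (*-suc k (pred o))) (cong (k *_) (suc-pred o)))))) (pow-cycle k)))

    power : ∀ x → ∃ λ k → pow C g k ≈ x
    power x with proj₂ cyclic x
    ... | ℤ.+ k , x≈    = k , ≈-sym x≈
    ... | -[1+ k ] , x≈ = suc k * pred o , ≈-trans (pow-⁻¹ (suc k)) (≈-sym x≈)

  log : Carrier → ℕ
  log x = proj₁ (power x) % o

  log< : ∀ x → log x < o
  log< x = m%n<n _ o

  pow-log : ∀ x → pow C g (log x) ≈ x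
  pow-log x = ≈-trans (pow-% _) (proj₂ (power x))

  -- `power` may give equal elements different exponents; below `o` the exponent is unique.
  log-cong : ∀ {x y} → x ≈ y → log x ≡ log y
  log-cong {x} {y} x≈y =
    pow-unique (log< x) (log< y) (≈-trans (pow-log x) (≈-trans x≈y (≈-sym (pow-log y))))

  log-injective : ∀ {x y} → log x ≡ log y → x ≈ y
  log-injective {x} {y} p =
    ≈-trans (≈-sym (pow-log x)) (≈-trans (reflexive (cong (pow C g) p)) (pow-log y))

  log-∙ : ∀ x y → log (x ∙ y) ≡ (log x + log y) % o
  log-∙ x y = pow-unique (log< _) (m%n<n _ o) (≈-trans (pow-log _) (≈-sym (≈-trans (pow-% _)
    (≈-trans (pow-+ (log x) (log y)) (∙-cong (pow-log x) (pow-log y))))))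

module Indexed {c ℓ} (A : AbelianGroup c ℓ) {N} (order : HasOrder (AbelianGroup.group A) N) where
  open AbelianGroup A renaming (isAbelianGroup to A-isAbelianGroup; sym to ≈-sym)
  open Finite {G = group} order

  _∙ᶠ_ : Op₂ (Fin N)
  i ∙ᶠ j = index (enum i ∙ enum j)

  private
    rawGroupᶠ : RawGroup _ _
    rawGroupᶠ = record { _≈_ = _≡_ ; _∙_ = _∙ᶠ_ ; ε = index ε ; _⁻¹ = λ i → index (enum i ⁻¹) }

    open GroupMorphisms rawGroupᶠ rawGroup

    enum-isMonomorphism : IsGroupMonomorphism enum
    enum-isMonomorphism = record
      { isGroupHomomorphism = record
        { isMonoidHomomorphism = record
          { isMagmaHomomorphism = record
            { isRelHomomorphism = record { cong = enum-cong }
            ; homo = λ _ _ → enum-index _ }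
          ; ε-homo = enum-index _ }
        ; ⁻¹-homo = λ _ → enum-index _ }
      ; injective = enum-injective }

  -- The laws are pulled back along `enum`, an injective homomorphism into the given group.
  isAbelianGroup : IsAbelianGroup _≡_ _∙ᶠ_ (index ε) (λ i → index (enum i ⁻¹))
  isAbelianGroup = GroupMonomorphism.isAbelianGroup enum-isMonomorphism A-isAbelianGroup

  index-∙ : ∀ x y → index (x ∙ y) ≡ index x ∙ᶠ index y
  index-∙ x y = index-cong (∙-cong (≈-sym (enum-index x)) (≈-sym (enum-index y)))

-- `index` numbers the component in the abelian group, and `exponent` is the discrete logarithm of
-- the cyclic component. `α` is the action of the generator, so its iterates give the whole action.
record Coordinates {c ℓ} (G : Group c ℓ) {N} (_∙ᶠ_ : Op₂ (Fin N)) (α : Fin N → Fin N) (o : ℕ) :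
                   Set (c ⊔ ℓ) where
  open Group G using (Carrier; _≈_; _∙_)
  field
    {{o≢0}}       : NonZero o
    index         : Carrier → Fin N
    exponent      : Carrier → ℕ
    exponent<     : ∀ x → exponent x < o
    index-cong    : ∀ {x y} → x ≈ y → index x ≡ index y
    exponent-cong : ∀ {x y} → x ≈ y → exponent x ≡ exponent y
    injective     : ∀ {x y} → index x ≡ index y → exponent x ≡ exponent y → x ≈ y
    index-∙       : ∀ x y → index (x ∙ y) ≡ index x ∙ᶠ fold (index y) α (exponent x)
    exponent-∙    : ∀ x y → exponent (x ∙ y) ≡ (exponent x + exponent y) % o

module SemidirectCoordinates {c ℓ} {G : Group c ℓ} (D : AbelianByCyclic G) where
  open AbelianByCyclic D
  private
    module G = Group G
    module A = AbelianGroup A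
    module C = Group C
    A⋊C = (A.group ⋊ C) φ φ-hom
    module A⋊C = Group A⋊C
    open GroupMorphisms A⋊C.rawGroup G.rawGroup using (module IsGroupIsomorphism)
    open GroupMorphisms C.rawGroup (Group.rawGroup (Aut A.group)) using (module IsGroupHomomorphism)
    module φ = IsGroupHomomorphism φ-hom
    module I = IsGroupIsomorphism (proj₂ iso)
    module F = Finite {G = A.group} A-order

  open Automorphism
  open Logarithm C C-order C-cyclic public
  open Indexed A A-order public

  α : Fin ∣A∣ → Fin ∣A∣
  α i = F.index (to (φ generator) (F.enum i))

  α-injective : Injective _≡_ _≡_ α
  α-injective p = F.enum-injective (injective (φ generator) (F.index-injective p))

  ∣A∣≤ : ∀ {n} → HasOrder G n → ∣A∣ ≤ n
  ∣A∣≤ G-order = order≤ {H = A.group} {G = G} A-order G-order (λ a → proj₁ iso (a , C.ε))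
    (λ p → proj₁ (I.injective p))

  o≤ : ∀ {n} → HasOrder G n → o ≤ n
  o≤ G-order = ≤-trans o≤m
    (order≤ {H = C} {G = G} C-order G-order (λ x → proj₁ iso (A.ε , x))
      (λ p → proj₂ (I.injective p)))

  private
    -- Because `φ` is a homomorphism, the k-th power of the generator acts as the k-th iterate of
    -- `α`.
    act-pow : ∀ k a → F.index (to (φ (pow C generator k)) a) ≡ fold (F.index a) α k
    act-pow zero    a = F.index-cong (φ.ε-homo a)
    act-pow (suc k) a = trans (F.index-cong (φ.homo generator (pow C generator k) a))
      (F.index-cong (⟦⟧-cong (φ generator)
        (A.trans (A.sym (F.enum-index _)) (F.enum-cong (act-pow k a)))))

    act : ∀ x a → F.index (to (φ x) a) ≡ fold (F.index a) α (log x)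
    act x a = trans (F.index-cong (φ.⟦⟧-cong (C.sym (pow-log x)) a)) (act-pow (log x) a)

    split : G.Carrier → A⋊C.Carrier
    split y = proj₁ (I.surjective y)

    join-split : ∀ y → proj₁ iso (split y) G.≈ y
    join-split y = proj₂ (I.surjective y) A⋊C.refl

    split-cong : ∀ {x y} → x G.≈ y → split x A⋊C.≈ split y
    split-cong {x} {y} p = I.injective (G.trans (join-split x) (G.trans p (G.sym (join-split y))))

    split-∙ : ∀ x y → split (x G.∙ y) A⋊C.≈ (split x A⋊C.∙ split y)
    split-∙ x y = I.injective (G.trans (join-split _) (G.sym (G.trans (I.∙-homo (split x) (split y))
      (G.∙-cong (join-split x) (join-split y)))))

  coordinates : Coordinates G _∙ᶠ_ α o
  coordinates = record
    { o≢0           = o≢0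
    ; index         = λ x → F.index (proj₁ (split x))
    ; exponent      = λ x → log (proj₂ (split x))
    ; exponent<     = λ x → log< _
    ; index-cong    = λ p → F.index-cong (proj₁ (split-cong p))
    ; exponent-cong = λ p → log-cong (proj₂ (split-cong p))
    ; injective     = λ {x} {y} p q → G.trans (G.sym (join-split x)) (G.trans
        (I.⟦⟧-cong (F.index-injective p , log-injective q)) (join-split y))
    ; index-∙       = λ x y → trans (F.index-cong (proj₁ (split-∙ x y)))
        (trans (index-∙ _ _) (cong (F.index (proj₁ (split x)) ∙ᶠ_) (act _ _)))
    ; exponent-∙    = λ x y → trans (log-cong (proj₂ (split-∙ x y))) (log-∙ _ _)
    }

-- The query program

pairTable : ∀ {p q} → (Fin p → Fin q → ℕ) → ℕ → ℕ
pairTable {p} {q} f = table (uncurry f ∘ remQuot {p} q)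

private
  toℕ-combine′ : ∀ {p q} (i : Fin p) (j : Fin q) → toℕ (combine i j) ≡ toℕ i * q + toℕ j
  toℕ-combine′ {q = q} i j = trans (toℕ-combine i j) (cong (_+ toℕ j) (*-comm q (toℕ i)))

pairTable-index : ∀ {p q} (f : Fin p → Fin q → ℕ) i j → pairTable f (toℕ i * q + toℕ j) ≡ f i j
pairTable-index f i j = trans (cong (pairTable f) (sym (toℕ-combine′ i j)))
  (trans (table-toℕ _ (combine i j)) (cong (uncurry f) (remQuot-combine i j)))

pairIndex< : ∀ {p q} (i : Fin p) (j : Fin q) → toℕ i * q + toℕ j < p * q
pairIndex< {p} {q} i j = subst (_< p * q) (toℕ-combine′ i j) (toℕ<n (combine i j))

-- Entry i of table number j has address 17 i + j. Constants are tables too, so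
-- that no base address needs to be stored. The tables 11, 12 and 13 hold the
-- carries 0, 1 and 2 (a sum of three heights below n is below 3 n).

base′ pos′ len′ orb′ mod′ coset′ sum′ height′ n′ low′ add′ carry′ element′ γ′ β′ : Fin 17
base′ = # 0
pos′ = # 1
len′ = # 2
orb′ = # 3
mod′ = # 4
coset′ = # 5
sum′ = # 6
height′ = # 7
n′ = # 8
low′ = # 9
add′ = # 10
carry′ = # 11
element′ = # 14
γ′ = # 15
β′ = # 16

-- Every fetch overwrites this register, hence the later side conditions `d≢tmp` and `x≢tmp`.
tmp : Fin 11
tmp = # 4

fetch : (d x : Fin 11) → Fin 17 → List (Instr 11)
fetch d x j =
  const tmp 17 ∷ binary d mul x tmp ∷ const tmp (toℕ j) ∷ binary d add d tmp ∷
  load d d ∷ []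

-- Here the table number itself is computed: the quotient in `q` is added to the address and so
-- selects one of three neighbouring tables.
fetchCarry : (d x q : Fin 11) → List (Instr 11)
fetchCarry d x q =
  const tmp 17 ∷ binary d mul x tmp ∷ const tmp (toℕ carry′) ∷ binary d add d tmp ∷
  binary d add d q ∷ load d d ∷ []

-- The query (a , k) , (b , l) is held in the registers 0 to 3; register 2 is
-- replaced by c = αᵏ(b), and register 3 by the representative s of the sum of
-- the cosets of a and c.

opaque
  program : List (Instr 11)
  program =
    fetch (# 5) (# 2) pos′ ++ binary (# 5) add (# 5) (# 1) ∷
    fetch (# 6) (# 2) len′ ++ binary (# 5) rem (# 5) (# 6) ∷
    fetch (# 6) (# 2) base′ ++ binary (# 5) add (# 6) (# 5) ∷
    fetch (# 2) (# 5) orb′ ++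
    -- A constant is the same in every row, so it is read from the row of `a`, whose index is at
    -- hand in register 0.
    binary (# 1) add (# 1) (# 3) ∷ fetch (# 5) (# 0) mod′ ++ binary (# 1) rem (# 1) (# 5) ∷
    fetch (# 5) (# 0) coset′ ++ fetch (# 3) (# 0) γ′ ++ binary (# 3) mul (# 5) (# 3) ∷
    fetch (# 5) (# 2) coset′ ++ binary (# 3) add (# 3) (# 5) ∷
    fetch (# 3) (# 3) sum′ ++
    fetch (# 5) (# 0) height′ ++
    fetch (# 6) (# 2) height′ ++ binary (# 5) add (# 5) (# 6) ∷
    fetch (# 6) (# 3) height′ ++ binary (# 5) add (# 5) (# 6) ∷
    -- Register 5 now holds the sum of the three heights. Its quotient by `n` chooses the carry, and
    -- its remainder is the height to look up.
    fetch (# 6) (# 0) n′ ++ binary (# 7) quo (# 5) (# 6) ∷ binary (# 5) rem (# 5) (# 6) ∷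
    fetchCarry (# 10) (# 0) (# 7) ++
    fetch (# 8) (# 0) β′ ++
    fetch (# 9) (# 0) low′ ++ binary (# 9) mul (# 9) (# 8) ∷
    fetch (# 7) (# 2) low′ ++ binary (# 9) add (# 9) (# 7) ∷ fetch (# 9) (# 9) add′ ++
    binary (# 9) mul (# 9) (# 8) ∷
    fetch (# 7) (# 3) low′ ++ binary (# 9) add (# 9) (# 7) ∷ fetch (# 9) (# 9) add′ ++
    binary (# 9) mul (# 9) (# 8) ∷ binary (# 9) add (# 9) (# 10) ∷ fetch (# 9) (# 9) add′ ++
    -- Horner's rule for the position of the triple (coset, height, base) in the element table.
    fetch (# 3) (# 3) coset′ ++ binary (# 3) mul (# 3) (# 6) ∷ binary (# 3) add (# 3) (# 5) ∷
    binary (# 3) mul (# 3) (# 8) ∷ binary (# 3) add (# 3) (# 9) ∷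
    fetch (# 0) (# 3) element′

-- Correctness of the query program

module Query (w : ℕ) {N ν o : ℕ} {{_ : NonZero o}} {op : Op₂ (Fin N)} {α : Fin N → Fin N}
             (T : AdditionTables op) (O : OrbitTables α)
             (N≤ν : N ≤ ν) (o≤ν : o ≤ ν) (17ν<2^w : 17 * ν < 2 ^ w) where

  open StraightLine w
  module T = AdditionTables T
  module O = OrbitTables O
  open T using (n; β; γ)

  sumEntry : Fin γ → Fin γ → ℕ
  sumEntry c c′ = toℕ (T.sum c c′)

  addEntry : Fin β → Fin β → ℕ
  addEntry i j = toℕ (T._⊞_ i j)

  -- Coset and height are merged into one index, which makes the three-dimensional table a
  -- two-dimensional one.
  elementEntry : Fin (γ * n) → Fin β → ℕ
  elementEntry x i = toℕ (uncurry T.element (remQuot {γ} n x) i)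

  fields : Vec (ℕ → ℕ) 17
  fields =
    table O.base ∷ table O.pos ∷ table O.len ∷ O.orb ∷ (λ _ → o) ∷
    table (toℕ ∘ T.coset) ∷ pairTable sumEntry ∷
    table (toℕ ∘ T.height) ∷ (λ _ → n) ∷
    table (toℕ ∘ T.base) ∷ pairTable addEntry ∷
    (λ _ → toℕ (T.carry 0)) ∷ (λ _ → toℕ (T.carry 1)) ∷ (λ _ → toℕ (T.carry 2)) ∷
    pairTable elementEntry ∷
    (λ _ → γ) ∷ (λ _ → β) ∷ []

  compressed : Vec (Word w) (N * 17)
  compressed = tabulate λ x → let i , j = remQuot {N} 17 x in toWord w (lookup fields j (toℕ i))

  -- The summand 0 is the empty working space.
  M : ℕ
  M = N * 17 + 0

  address< : ∀ {i} → i < N → (j : Fin 17) → i * 17 + toℕ j < N * 17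
  address< {i} i<N j = subst (λ i → i * 17 + toℕ j < N * 17) (toℕ-fromℕ< i<N)
    (pairIndex< (fromℕ< i<N) j)

  address<M : ∀ {i} → i < N → (j : Fin 17) → i * 17 + toℕ j < M
  address<M i<N j = <-≤-trans (address< i<N j) (m≤m+n (N * 17) 0)

  M≤17ν : M ≤ 17 * ν
  M≤17ν = ≤-trans (≤-reflexive (trans (+-identityʳ (N * 17)) (*-comm N 17))) (*-monoʳ-≤ 17 N≤ν)

  -- Three summands are needed for the total of three heights, the longest sum that is divided.
  fits : ∀ {a b c} → a ≤ ν → b ≤ ν → c ≤ ν → a + b + c < 2 ^ w
  fits a≤ b≤ c≤ = ≤-<-trans (≤-trans (+-mono-≤ (+-mono-≤ a≤ b≤) c≤) 3ν≤17ν) 17ν<2^w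
    where
    3ν≤17ν : ν + ν + ν ≤ 17 * ν
    3ν≤17ν = ≤-trans (≤-reflexive (trans (+-assoc ν ν ν)
      (cong (λ x → ν + (ν + x)) (sym (+-identityʳ ν)))))
      (*-monoˡ-≤ ν {3} {17} (s≤s (s≤s (s≤s z≤n))))

  fits₂ : ∀ {a b} → a ≤ ν → b ≤ ν → a + b < 2 ^ w
  fits₂ a≤ b≤ = subst (_< 2 ^ w) (+-identityʳ _) (fits a≤ b≤ z≤n)

  fits₁ : ∀ {a} → a ≤ ν → a < 2 ^ w
  fits₁ a≤ = subst (_< 2 ^ w) (+-identityʳ _) (fits₂ a≤ z≤n)

  module _ (work : Vec (Word w) 0) where

    μ : Vec (Word w) M
    μ = compressed Vec.++ work

    lookup-μ : ∀ {i a} (i<N : i < N) (j : Fin 17) (a≡ : a ≡ i * 17 + toℕ j) (a<M : a < M) →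
               lookup μ (fromℕ< a<M) ≡ toWord w (lookup fields j i)
    lookup-μ {i} i<N j refl a<M = trans (lookup-++-< compressed work (fromℕ< a<M) x<)
      (trans (cong (lookup compressed) (toℕ-injective
        (trans (toℕ-fromℕ< x<) (trans (toℕ-fromℕ< a<M) x≡))))
      (trans (lookup∘tabulate _ (combine (fromℕ< i<N) j))
      (trans (cong (λ (i , j) → toWord w (lookup fields j (toℕ i)))
        (remQuot-combine (fromℕ< i<N) j))
        (cong (toWord w ∘ lookup fields j) (toℕ-fromℕ< i<N)))))
      where
      x< : toℕ (fromℕ< a<M) < N * 17
      x< = subst (_< N * 17) (sym (toℕ-fromℕ< a<M)) (address< i<N j)

      x≡ : i * 17 + toℕ j ≡ toℕ (combine (fromℕ< i<N) j)
      x≡ = trans (cong (λ i → i * 17 + toℕ j) (sym (toℕ-fromℕ< i<N)))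
        (sym (toℕ-combine′ (fromℕ< i<N) j))

    -- The overwritten values are kept, so that the registers match the execution rules write for
    -- write.
    prepare : Vec ℕ 11 → (d : Fin 11) → ℕ → ℕ → Vec ℕ 11
    prepare R d i j = R [ tmp ]≔ 17 [ d ]≔ i * 17 [ tmp ]≔ j

    address : Vec ℕ 11 → (d : Fin 11) → ℕ → ℕ → Vec ℕ 11
    address R d i j = prepare R d i j [ d ]≔ (i * 17 + j)

    module _ {R : Vec ℕ 11} {d x : Fin 11}
             {d≢tmp : False (d Fin.≟ tmp)} {x≢tmp : False (x Fin.≟ tmp)} where

      addressᴱ : ∀ {P R′ i j} → lookup R x ≡ i → Exec μ P (address R d i j) R′ →
        Exec μ (const tmp 17 ∷ binary d mul x tmp ∷ const tmp j ∷ binary d add d tmp ∷ P) R R′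
      addressᴱ {j = j} refl e = constᴱ (mulᴱ _
        (cong₂ _*_ (lookup∘update′ (toWitnessFalse x≢tmp) R 17) (lookup∘update tmp R 17))
        (constᴱ (addᴱ _ (cong₂ _+_
          (trans (lookup∘update′ (toWitnessFalse d≢tmp) (R [ tmp ]≔ 17 [ d ]≔ lookup R x * 17) j)
            (lookup∘update d (R [ tmp ]≔ 17) (lookup R x * 17)))
          (lookup∘update tmp (R [ tmp ]≔ 17 [ d ]≔ lookup R x * 17) j)) e)))

      lookup-address : ∀ i j → lookup (address R d i j) d ≡ i * 17 + j
      lookup-address i j = lookup∘update d (prepare R d i j) _

      -- The value is passed as `v` with an equation, so that later register contents mention the
      -- mathematical object and not a table expression.
      fetchᴱ : ∀ {P R′ j} i v → lookup R x ≡ i → i < N → lookup fields j i ≡ v →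
               Exec μ P (address R d i (toℕ j) [ d ]≔ v) R′ → Exec μ (fetch d x j ++ P) R R′
      fetchᴱ {j = j} i v R≡ i<N refl e = addressᴱ R≡
        (loadᴱ (<-≤-trans a<M (≤-trans M≤17ν (<⇒≤ 17ν<2^w))) a<M (lookup-μ i<N j a≡ a<M) e)
        where
        a≡ : lookup (address R d i (toℕ j)) d ≡ i * 17 + toℕ j
        a≡ = lookup-address i (toℕ j)

        a<M : lookup (address R d i (toℕ j)) d < M
        a<M = subst (_< M) (sym a≡) (address<M i<N j)

      fetchCarryᴱ : ∀ {P R′ y} i q → lookup R x ≡ i → i < N →
        lookup (address R d i 11) y ≡ q → q < 3 →
        Exec μ P (address R d i 11 [ d ]≔ (i * 17 + 11 + q) [ d ]≔ toℕ (T.carry q)) R′ →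
        Exec μ (fetchCarry d x y ++ P) R R′
      fetchCarryᴱ {y = y} i q R≡ i<N y≡ q<3 e = addressᴱ R≡
        (addᴱ _ (cong₂ _+_ (lookup-address i 11) y≡)
        (loadᴱ (<-≤-trans a<M (≤-trans M≤17ν (<⇒≤ 17ν<2^w))) a<M
          (trans (lookup-μ i<N (carryField q q<3) a≡ a<M)
            (cong (toWord w) (carryField-lookup q q<3))) e))
        where
        carryField : ∀ q → q < 3 → Fin 17
        carryField 0 _ = # 11
        carryField 1 _ = # 12
        carryField 2 _ = # 13
        carryField (suc (suc (suc _))) (s≤s (s≤s (s≤s ())))

        carryField-toℕ : ∀ q (q<3 : q < 3) → 11 + q ≡ toℕ (carryField q q<3)
        carryField-toℕ 0 _ = refl
        carryField-toℕ 1 _ = refl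
        carryField-toℕ 2 _ = refl
        carryField-toℕ (suc (suc (suc _))) (s≤s (s≤s (s≤s ())))

        carryField-lookup : ∀ q (q<3 : q < 3) → lookup fields (carryField q q<3) i ≡ toℕ (T.carry q)
        carryField-lookup 0 _ = refl
        carryField-lookup 1 _ = refl
        carryField-lookup 2 _ = refl
        carryField-lookup (suc (suc (suc _))) (s≤s (s≤s (s≤s ())))

        a≡ : lookup (address R d i 11 [ d ]≔ (i * 17 + 11 + q)) d ≡ i * 17 + toℕ (carryField q q<3)
        a≡ = trans (lookup∘update d (address R d i 11) _)
          (trans (+-assoc (i * 17) 11 q) (cong (i * 17 +_) (carryField-toℕ q q<3)))

        a<M : lookup (address R d i 11 [ d ]≔ (i * 17 + 11 + q)) d < M
        a<M = subst (_< M) (sym a≡) (address<M i<N (carryField q q<3))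

    module _ (a b : Fin N) {k l : ℕ} (k<o : k < o) (l<o : l < o) where

      private
        c s : Fin N
        c = fold b α k
        s = T.sum (T.coset a) (T.coset c)

        Z : ℕ
        Z = T.total a c

        instance
          len≢0 : NonZero (O.len b)
          len≢0 = O.len≢0 b

          n≢0 : NonZero n
          n≢0 = T.n≢0

        low : Fin β
        low = T._⊞_ (T._⊞_ (T.base a) (T.base c)) (T.base s)

        last : Fin β
        last = T._⊞_ low (T.carry (Z / n))

        Z<3n : Z < 3 * n
        Z<3n = ≤-trans
          (+-mono-<-≤ (+-mono-< (toℕ<n (T.height a)) (toℕ<n (T.height c))) (<⇒≤ (toℕ<n (T.height s))))
          (≤-reflexive (trans (+-assoc n n n) (cong (λ x → n + (n + x)) (sym (+-identityʳ n)))))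

        n≤ν : n ≤ ν
        n≤ν = ≤-trans T.n≤N N≤ν

        k≤ν : k ≤ ν
        k≤ν = ≤-trans (<⇒≤ k<o) o≤ν

        l≤ν : l ≤ ν
        l≤ν = ≤-trans (<⇒≤ l<o) o≤ν

        height≤ν : ∀ x → toℕ (T.height x) ≤ ν
        height≤ν x = ≤-trans (<⇒≤ (toℕ<n (T.height x))) n≤ν

        Z<2^w : Z < 2 ^ w
        Z<2^w = fits (height≤ν a) (height≤ν c) (height≤ν s)

        elementIndex : toℕ (combine (T.coset s) (Z mod n)) ≡ toℕ (T.coset s) * n + Z % n
        elementIndex = trans (toℕ-combine′ (T.coset s) (Z mod n))
          (cong (toℕ (T.coset s) * n +_) (toℕ-fromℕ< (m%n<n Z n)))

        -- The entry is the product by `∙-tables`; the coset and the remainder are recovered from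
        -- their merged index.
        element-lookup : lookup fields element′
            (toℕ (combine (T.coset s) (Z mod n)) * β + toℕ last) ≡ toℕ (op a c)
        element-lookup = trans (pairTable-index elementEntry (combine (T.coset s) (Z mod n)) last)
          (cong toℕ (trans (cong (λ x → uncurry T.element x last)
            (remQuot-combine (T.coset s) (Z mod n)))
            (sym (T.∙-tables a c))))

        element< : toℕ (combine (T.coset s) (Z mod n)) * β + toℕ last < N
        element< = <-≤-trans (pairIndex< (combine (T.coset s) (Z mod n)) last)
          (≤-trans (≤-reflexive (*-assoc γ n β)) T.γnβ≤N)

        add< : ∀ i j → toℕ i * β + toℕ j < N
        add< i j = <-≤-trans (pairIndex< {β} {β} i j) T.β²≤N

      opaque
        unfolding program

        -- The rules follow the program and name the number each step produces. What has to be
        -- supplied are the table entries and the bounds on addresses and on operands of divisions.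
        -- The scratch values are arbitrary.
        program-Exec : ∀ r₄ r₅ r₆ r₇ r₈ r₉ r₁₀ → ∃ λ R → Exec μ program
          (toℕ a ∷ k ∷ toℕ b ∷ l ∷ r₄ ∷ r₅ ∷ r₆ ∷ r₇ ∷ r₈ ∷ r₉ ∷ r₁₀ ∷ [])
          (toℕ (op a c) ∷ (k + l) % o ∷ R)
        program-Exec r₄ r₅ r₆ r₇ r₈ r₉ r₁₀ = _ ,
          (fetchᴱ (toℕ b) (O.pos b) refl (toℕ<n b) (table-toℕ O.pos b)
          (addᴱ (O.pos b + k) refl
          (fetchᴱ (toℕ b) (O.len b) refl (toℕ<n b) (table-toℕ O.len b)
          (remᴱ (O.pos b + k) (O.len b) refl refl
            (fits₂ (≤-trans (<⇒≤ (O.pos< b)) N≤ν) k≤ν) (fits₁ (≤-trans (O.len≤ b) N≤ν))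
          (fetchᴱ (toℕ b) (O.base b) refl (toℕ<n b) (table-toℕ O.base b)
          (addᴱ slot refl
          (fetchᴱ slot (toℕ c) refl (O.slot< b k) (O.orb-slot b k)
          (addᴱ (k + l) refl
          (fetchᴱ (toℕ a) o refl (toℕ<n a) refl
          (remᴱ (k + l) o refl refl (fits₂ k≤ν l≤ν) (fits₁ o≤ν)
          (fetchᴱ (toℕ a) (toℕ (T.coset a)) refl (toℕ<n a) (table-toℕ _ a)
          (fetchᴱ (toℕ a) γ refl (toℕ<n a) refl
          (mulᴱ (toℕ (T.coset a) * γ) refl
          (fetchᴱ (toℕ c) (toℕ (T.coset c)) refl (toℕ<n c) (table-toℕ _ c)
          (addᴱ (toℕ (T.coset a) * γ + toℕ (T.coset c)) refl
          (fetchᴱ (toℕ (T.coset a) * γ + toℕ (T.coset c)) (toℕ s) refl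
            (<-≤-trans (pairIndex< (T.coset a) (T.coset c)) T.γ²≤N)
            (pairTable-index sumEntry (T.coset a) (T.coset c))
          (fetchᴱ (toℕ a) (toℕ (T.height a)) refl (toℕ<n a) (table-toℕ _ a)
          (fetchᴱ (toℕ c) (toℕ (T.height c)) refl (toℕ<n c) (table-toℕ _ c)
          (addᴱ (toℕ (T.height a) + toℕ (T.height c)) refl
          (fetchᴱ (toℕ s) (toℕ (T.height s)) refl (toℕ<n s) (table-toℕ _ s)
          (addᴱ Z refl
          (fetchᴱ (toℕ a) n refl (toℕ<n a) refl
          (quoᴱ Z n refl refl Z<2^w (fits₁ n≤ν)
          (remᴱ Z n refl refl Z<2^w (fits₁ n≤ν)
          (fetchCarryᴱ (toℕ a) (Z / n) refl (toℕ<n a) refl (m<n*o⇒m/o<n Z<3n)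
          (fetchᴱ (toℕ a) β refl (toℕ<n a) refl
          (fetchᴱ (toℕ a) (toℕ (T.base a)) refl (toℕ<n a) (table-toℕ _ a)
          (mulᴱ (toℕ (T.base a) * β) refl
          (fetchᴱ (toℕ c) (toℕ (T.base c)) refl (toℕ<n c) (table-toℕ _ c)
          (addᴱ (toℕ (T.base a) * β + toℕ (T.base c)) refl
          (fetchᴱ (toℕ (T.base a) * β + toℕ (T.base c)) (toℕ low₂) refl
            (add< (T.base a) (T.base c)) (pairTable-index addEntry (T.base a) (T.base c))
          (mulᴱ (toℕ low₂ * β) refl
          (fetchᴱ (toℕ s) (toℕ (T.base s)) refl (toℕ<n s) (table-toℕ _ s)
          (addᴱ (toℕ low₂ * β + toℕ (T.base s)) refl
          (fetchᴱ (toℕ low₂ * β + toℕ (T.base s)) (toℕ low) refl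
            (add< low₂ (T.base s)) (pairTable-index addEntry low₂ (T.base s))
          (mulᴱ (toℕ low * β) refl
          (addᴱ (toℕ low * β + toℕ (T.carry (Z / n))) refl
          (fetchᴱ (toℕ low * β + toℕ (T.carry (Z / n))) (toℕ last) refl
            (add< low (T.carry (Z / n))) (pairTable-index addEntry low (T.carry (Z / n)))
          (fetchᴱ (toℕ s) (toℕ (T.coset s)) refl (toℕ<n s) (table-toℕ _ s)
          (mulᴱ (toℕ (T.coset s) * n) refl
          -- The sum is renamed to a `combine`, the form in which the element table is indexed.
          (addᴱ x (sym elementIndex)
          (mulᴱ (x * β) refl
          (addᴱ (x * β + toℕ last) refl
          (fetchᴱ (x * β + toℕ last) (toℕ (op a c)) refl element< element-lookup
          done))))))))))))))))))))))))))))))))))))))))))))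
            where
            slot x : ℕ
            slot = O.base b + (O.pos b + k) % O.len b
            x = toℕ (combine (T.coset s) (Z mod n))
            low₂ : Fin β
            low₂ = T._⊞_ (T.base a) (T.base c)

-- Word length

n≤2^⌈log₂n⌉ : ∀ n → n ≤ 2 ^ ⌈log₂ n ⌉
n≤2^⌈log₂n⌉ = <-rec _ λ where
  0 _ → z≤n
  1 _ → s≤s z≤n
  n@(suc (suc m)) rec → let open ≤-Reasoning in begin
    n                              ≡⟨ ⌊n/2⌋+⌈n/2⌉≡n n ⟨
    -- Rounding up gives n ≤ 2 ⌈n/2⌉, and halving lowers the logarithm by one. The truncated
    -- subtraction is exact because n ≥ 2.
    ⌊ n /2⌋ + ⌈ n /2⌉              ≤⟨ +-monoˡ-≤ ⌈ n /2⌉ (⌊n/2⌋≤⌈n/2⌉ n) ⟩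
    ⌈ n /2⌉ + ⌈ n /2⌉              ≡⟨ cong (⌈ n /2⌉ +_) (+-identityʳ ⌈ n /2⌉) ⟨
    2 * ⌈ n /2⌉                    ≤⟨ *-monoʳ-≤ 2 (rec (⌈n/2⌉<n m)) ⟩
    2 * 2 ^ ⌈log₂ ⌈ n /2⌉ ⌉        ≡⟨ cong (λ l → 2 * 2 ^ l) (⌈log₂⌈n/2⌉⌉≡⌈log₂n⌉∸1 n) ⟩
    2 ^ suc (⌈log₂ n ⌉ ∸ 1)        ≡⟨ cong (2 ^_) (m+[n∸m]≡n (⌈log₂⌉-mono-≤ {2} (m≤m+n 2 m))) ⟩
    2 ^ ⌈log₂ n ⌉                  ∎

-- 6 = 1 + 5: one `L` covers n + 1, and five more give a factor of at least 32 > 17, since L ≥ 1.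
17n<2^wordSize : ∀ n → 1 ≤ n → 17 * n < 2 ^ wordSize 6 n
17n<2^wordSize n 1≤n = let open ≤-Reasoning in begin-strict
  17 * n                   ≤⟨ *-monoˡ-≤ n (m≤m+n 17 15) ⟩
  32 * n                   <⟨ *-monoʳ-< 32 (n<1+n n) ⟩
  32 * suc n               ≡⟨ *-comm 32 (suc n) ⟩
  suc n * 2 ^ 5            ≤⟨ *-mono-≤ (n≤2^⌈log₂n⌉ (suc n)) (^-monoʳ-≤ 2 (*-monoʳ-≤ 5 1≤L)) ⟩
  2 ^ L * 2 ^ (5 * L)      ≡⟨ ^-distribˡ-+-* 2 L (5 * L) ⟨
  2 ^ (6 * L)              ∎
  where
  L : ℕ
  L = ⌈log₂ suc n ⌉

  1≤L : 1 ≤ L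
  1≤L = ⌈log₂⌉-mono-≤ (s≤s 1≤n)

-- Assembling the representation

queryProgram : QueryProgram
queryProgram = record { labelWords = 2 ; scratchWords = 7 ; code = program }

module _ {c ℓ} {G : Group c ℓ} {N o ν w : ℕ} {op : Op₂ (Fin N)} {α : Fin N → Fin N}
         (K : Coordinates G op α o) (T : AdditionTables op) (O : OrbitTables α)
         (N≤ν : N ≤ ν) (o≤ν : o ≤ ν) (17ν<2^w : 17 * ν < 2 ^ w) where
  private
    module K = Coordinates K
    open StraightLine w
    module Q = Query w {{K.o≢0}} T O N≤ν o≤ν 17ν<2^w

    toWord-injective : ∀ {a b} → a < 2 ^ w → b < 2 ^ w → toWord w a ≡ toWord w b → a ≡ b
    toWord-injective a< b< p = trans (sym (toℕ-toWord-< a<)) (trans (cong toℕ p) (toℕ-toWord-< b<))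

    label : Group.Carrier G → Vec (Word w) 2
    label x = toWord w (toℕ (K.index x)) ∷ toWord w (K.exponent x) ∷ []

    -- Executions start from natural numbers, so arbitrary scratch words must be written as images
    -- of such.
    map-toWord-toℕ : ∀ {k} (xs : Vec (Word w) k) → Vec.map (toWord w) (Vec.map toℕ xs) ≡ xs
    map-toWord-toℕ xs =
      trans (sym (map-∘ (toWord w) toℕ xs)) (trans (map-cong toWord-toℕ xs) (map-id xs))

  representation : Representation queryProgram w (length program) G
  representation = record
    { formWords = N * 17
    ; workWords = 0
    ; compressed = Q.compressed
    ; label = label
    ; label-cong = λ p → cong₂ (λ i k → toWord w (toℕ i) ∷ toWord w k ∷ [])
        (K.index-cong p) (K.exponent-cong p)
    ; label-injective = λ {x} {y} p → K.injective
        (toℕ-injective (toWord-injective (index-fits x) (index-fits y) (proj₁ (∷-injective p))))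
        (toWord-injective (exponent-fits x) (exponent-fits y)
          (proj₁ (∷-injective (proj₂ (∷-injective p)))))
    ; multiply = multiply
    }
    where
    index-fits : ∀ x → toℕ (K.index x) < 2 ^ w
    index-fits x = Q.fits₁ (≤-trans (<⇒≤ (toℕ<n (K.index x))) N≤ν)

    exponent-fits : ∀ x → K.exponent x < 2 ^ w
    exponent-fits x = Q.fits₁ (≤-trans (<⇒≤ (K.exponent< x)) o≤ν)

    open Group G using (_∙_)

    multiply : ∀ x y (scratch : Vec (Word w) 7) (work : Vec (Word w) 0) →
      ∃ λ (σ : State 11 w (N * 17 + 0)) →
        run program (length program)
          ⟨ 0 , label x Vec.++ (label y Vec.++ scratch) , Q.compressed Vec.++ work ⟩ ≡ just σ
        × take 2 (regs σ) ≡ label (x ∙ y)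
        × take (N * 17) (mem σ) ≡ Q.compressed
    multiply x y scratch@(r₄ ∷ r₅ ∷ r₆ ∷ r₇ ∷ r₈ ∷ r₉ ∷ r₁₀ ∷ []) work
      with R , e ← Q.program-Exec work (K.index x) (K.index y) (K.exponent< x) (K.exponent< y)
             (toℕ r₄) (toℕ r₅) (toℕ r₆) (toℕ r₇) (toℕ r₈) (toℕ r₉) (toℕ r₁₀)
      with q , r ← run-Exec (Q.μ work) program {p = 0} refl e
      = _
      , trans (cong (λ s → run program (length program)
                  ⟨ 0 , label x Vec.++ (label y Vec.++ s) , Q.μ work ⟩)
                (sym (map-toWord-toℕ scratch))) r
      , sym (cong₂ (λ i k → toWord w (toℕ i) ∷ toWord w k ∷ []) (K.index-∙ x y) (K.exponent-∙ x y))
      , ++-injectiveˡ _ _ (take++drop≡id (N * 17) (Q.μ work))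

theorem6 : ∀ {c ℓ} →
    Σ[ Q ∈ QueryProgram ] ∃[ κ ] ∃[ S ] ∃[ T ] 1 ≤ κ ×
    (∀ (G : Group c ℓ) (n : ℕ) → HasOrder G n → (D : AbelianByCyclic G) →
    Σ[ R ∈ Representation Q (wordSize κ n) T G ]
    Representation.space R ≤ S * AbelianByCyclic.∣A∣ D)
-- 28 = 17 + 11: seventeen cells for each element of `A`, and eleven registers, which are absorbed
-- because |A| ≥ 1. The time is one unit per instruction.
theorem6 = queryProgram , 6 , 28 , length program , s≤s z≤n , λ G n G-order D →
  let open SemidirectCoordinates {G = G} D
      open AbelianByCyclic D using (∣A∣)
      1≤∣A∣ = ≤-<-trans z≤n (toℕ<n (Coordinates.index coordinates (Group.ε G)))
  in representation coordinates
       (FiniteAbelian.additionTables isAbelianGroup) (Orbits.orbitTables α α-injective)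
       (∣A∣≤ G-order) (o≤ G-order)
       (17n<2^wordSize n (≤-trans 1≤∣A∣ (∣A∣≤ G-order)))
   , (let open ≤-Reasoning in begin
       ∣A∣ * 17 + 0 + 11     ≡⟨ cong (_+ 11) (trans (+-identityʳ (∣A∣ * 17)) (*-comm ∣A∣ 17)) ⟩
       17 * ∣A∣ + 11         ≤⟨ +-monoʳ-≤ (17 * ∣A∣) (*-monoʳ-≤ 11 1≤∣A∣) ⟩
       17 * ∣A∣ + 11 * ∣A∣   ≡⟨ *-distribʳ-+ ∣A∣ 17 11 ⟨
       28 * ∣A∣              ∎)
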